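{- Let $m, n$ be two positive integers, let $\varepsilon$ be a positive real number, and let $G$ be a connected non-complete graph of even order with $t(G)\geq 1+\varepsilon$. If $\kappa(G)>\frac{(2m+2n-2)(1+\varepsilon)}{\varepsilon}$, then $G$ is $E(m,n)$-extendable.
   Context: All graphs are finite, simple and connected. The order of $G$ is $|V(G)|$, $\kappa(G)$ denotes the vertex connectivity of $G$, and $c(H)$ denotes the number of connected components of a graph $H$. For a non-complete graph $G$, the toughness is $t(G)=\min \frac{|S|}{c(G-S)}$, the minimum taken over all vertex cut-sets $S\subset V(G)$ (sets $S$ for which $G-S$ is disconnected). A matching is a set of pairwise independent (vertex-disjoint) edges; a $k$-matching is a matching with exactly $k$ edges; a perfect matching is a matching covering all vertices. A connected graph $H$ with a perfect matching and $|V(H)|\geq 2m+2$ is called $m$-extendable if every $m$-matching of $H$ is contained in a perfect matching of $H$. A connected graph $G$ with a perfect matching and at least $2m+2n+2$ vertices is called $E(m,n)$-extendable if, after deleting the edges of any $n$-matching of $G$, the resulting graph is $m$-extendable; in other words, for any two matchings $M$ and $N$ of $G$ with $M\cap N=\emptyset$ (as edge sets), $|M|=m$ and $|N|=n$, there is a perfect matching $F$ of $G$ such that $M\subseteq F$ and $N\cap F=\emptyset$. -}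

module Defs where

open import Data.Fin using (Fin)
open import Data.Fin.Properties using () renaming (_≟_ to _≟ꟳ_)
open import Data.Fin.Subset using (Subset; _∈_; ∁; ∣_∣)
open import Data.Integer using (+_)
open import Data.List using (List; length)
open import Data.List.Relation.Unary.All using (All)
open import Data.List.Relation.Unary.AllPairs using (AllPairs)
open import Data.List.Relation.Unary.Any as Any using (Any; any?)
open import Data.Nat as ℕ using (ℕ; suc)
import Data.Nat.Properties as ℕₚ
open import Data.Product using (_×_; _,_; Σ-syntax; ∃; ∃₂; proj₁; proj₂; swap; uncurry)
open import Data.Product.Properties using (≡-dec)
open import Data.Rational as ℚ using (ℚ; 0ℚ; 1ℚ; ½)
import Data.Rational.Properties as ℚₚ
open import Data.Rational.Solver using (module +-*-Solver)
open import Data.Sum using (_⊎_; inj₁; inj₂)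
open import Function using (_∘_; _⇔_)
open import Level using (0ℓ)
open import Relation.Binary using (Rel; Decidable; Symmetric; Irreflexive)
open import Relation.Binary.Construct.Closure.ReflexiveTransitive using (Star)
open import Relation.Binary.PropositionalEquality
open import Relation.Nullary using (¬_)
open import Relation.Nullary.Decidable using (_×-dec_; _⊎-dec_; ¬?)

-- Different Cauchy sequences may represent the same real number, so _≡_ on ℝ
-- is finer than equality of reals.
record ℝ : Set where
  constructor mkℝ
  field
    seq    : ℕ → ℚ
    cauchy : ∀ δ → .{{ℚ.Positive δ}} →
             ∃ λ N → ∀ {i j} → N ℕ.≤ i → N ℕ.≤ j →
             ℚ.∣ seq i ℚ.- seq j ∣ ℚ.≤ δ

open ℝ public

infix 4 _<ᵣ_ _≤ᵣ_

_<ᵣ_ : Rel ℝ 0ℓ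
x <ᵣ y = Σ[ δ ∈ ℚ ] ℚ.Positive δ ×
         ∃ λ N → ∀ {i} → N ℕ.≤ i → seq x i ℚ.+ δ ℚ.≤ seq y i

_≤ᵣ_ : Rel ℝ 0ℓ
x ≤ᵣ y = ¬ (y <ᵣ x)

fromℚ : ℚ → ℝ
fromℚ q .seq _ = q
fromℚ q .cauchy δ = 0 , λ _ _ → subst (ℚ._≤ δ)
  (sym (cong ℚ.∣_∣ (ℚₚ.+-inverseʳ q))) (ℚₚ.<⇒≤ (ℚₚ.positive⁻¹ δ))

fromℕ : ℕ → ℝ
fromℕ n = fromℚ (+ n ℚ./ 1)

0ᵣ 1ᵣ : ℝ
0ᵣ = fromℕ 0
1ᵣ = fromℕ 1

private

  open +-*-Solver using (solve; _:+_; _:*_; _:-_; _:=_)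

  diff-+ : ∀ a b c d → (a ℚ.+ b) ℚ.- (c ℚ.+ d) ≡ (a ℚ.- c) ℚ.+ (b ℚ.- d)
  diff-+ = solve 4 (λ a b c d → (a :+ b) :- (c :+ d) := (a :- c) :+ (b :- d)) refl

  diff-* : ∀ a b c d → a ℚ.* b ℚ.- c ℚ.* d ≡ (a ℚ.- c) ℚ.* b ℚ.+ (b ℚ.- d) ℚ.* c
  diff-* = solve 4 (λ a b c d → a :* b :- c :* d := (a :- c) :* b :+ (b :- d) :* c) refl

  diff-inv : ∀ u v a b → (u ℚ.- v) ℚ.* (a ℚ.* b) ≡ u ℚ.* a ℚ.* b ℚ.- v ℚ.* b ℚ.* a
  diff-inv = solve 4 (λ u v a b → (u :- v) :* (a :* b) := u :* a :* b :- v :* b :* a) refl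

  halves : ∀ δ → ½ ℚ.* δ ℚ.+ ½ ℚ.* δ ≡ δ
  halves δ = trans (sym (ℚₚ.*-distribʳ-+ δ ½ ½)) (ℚₚ.*-identityˡ δ)

  half-pos : ∀ δ → .{{ℚ.Positive δ}} → ℚ.Positive (½ ℚ.* δ)
  half-pos δ = ℚₚ.pos*pos⇒pos ½ δ

  bounded : ∀ (x : ℝ) → Σ[ B ∈ ℚ ] ℚ.Positive B ×
            ∃ λ N → ∀ {i} → N ℕ.≤ i → ℚ.∣ seq x i ∣ ℚ.≤ B
  bounded x with cauchy x 1ℚ
  ... | N , close = 1ℚ ℚ.+ ℚ.∣ xN ∣ , pos , N , bound
    where
    open ℚₚ.≤-Reasoning
    xN = seq x N
    pos : ℚ.Positive (1ℚ ℚ.+ ℚ.∣ xN ∣)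
    pos = ℚ.positive (ℚₚ.+-mono-<-≤ (ℚₚ.positive⁻¹ 1ℚ) (ℚₚ.0≤∣p∣ xN))
    bound : ∀ {i} → N ℕ.≤ i → ℚ.∣ seq x i ∣ ℚ.≤ 1ℚ ℚ.+ ℚ.∣ xN ∣
    bound {i} N≤i = begin
      ℚ.∣ seq x i ∣                       ≡⟨ cong ℚ.∣_∣ (solve 2 (λ a b → a := (a :- b) :+ b) refl (seq x i) xN) ⟩
      ℚ.∣ (seq x i ℚ.- xN) ℚ.+ xN ∣       ≤⟨ ℚₚ.∣p+q∣≤∣p∣+∣q∣ (seq x i ℚ.- xN) xN ⟩
      ℚ.∣ seq x i ℚ.- xN ∣ ℚ.+ ℚ.∣ xN ∣   ≤⟨ ℚₚ.+-monoˡ-≤ ℚ.∣ xN ∣ (close N≤i ℕₚ.≤-refl) ⟩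
      1ℚ ℚ.+ ℚ.∣ xN ∣                     ∎

  scaled : ∀ δ B → .{{ℚ.Positive δ}} → .{{ℚ.Positive B}} →
           Σ[ η ∈ ℚ ] ℚ.Positive η × η ℚ.* B ≡ δ
  scaled δ B {{_}} {{B>0}} = δ ℚ.* 1/B , ℚₚ.pos*pos⇒pos δ 1/B {{ℚₚ.1/pos⇒pos B}} ,
    trans (ℚₚ.*-assoc δ 1/B B)
          (trans (cong (δ ℚ.*_) (ℚₚ.*-inverseˡ B)) (ℚₚ.*-identityʳ δ))
    where
    instance _ = ℚₚ.pos⇒nonZero B
    1/B = ℚ.1/ B

  *-mono-≤ : ∀ {p q r s} → 0ℚ ℚ.≤ r → 0ℚ ℚ.≤ q → p ℚ.≤ q → r ℚ.≤ s → p ℚ.* r ℚ.≤ q ℚ.* s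
  *-mono-≤ {p} {q} {r} {s} 0≤r 0≤q p≤q r≤s = ℚₚ.≤-trans
    (ℚₚ.*-monoʳ-≤-nonNeg r {{ℚ.nonNegative 0≤r}} p≤q)
    (ℚₚ.*-monoˡ-≤-nonNeg q {{ℚ.nonNegative 0≤q}} r≤s)

  product-close : ∀ {a b c d η θ A B} →
    ℚ.∣ a ℚ.- c ∣ ℚ.≤ η → ℚ.∣ b ∣ ℚ.≤ B → 0ℚ ℚ.≤ η →
    ℚ.∣ b ℚ.- d ∣ ℚ.≤ θ → ℚ.∣ c ∣ ℚ.≤ A → 0ℚ ℚ.≤ θ →
    ℚ.∣ a ℚ.* b ℚ.- c ℚ.* d ∣ ℚ.≤ η ℚ.* B ℚ.+ θ ℚ.* A
  product-close {a} {b} {c} {d} {η} {θ} {A} {B} ac b≤B 0≤η bd c≤A 0≤θ = begin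
    ℚ.∣ a ℚ.* b ℚ.- c ℚ.* d ∣
      ≡⟨ cong ℚ.∣_∣ (diff-* a b c d) ⟩
    ℚ.∣ (a ℚ.- c) ℚ.* b ℚ.+ (b ℚ.- d) ℚ.* c ∣
      ≤⟨ ℚₚ.∣p+q∣≤∣p∣+∣q∣ ((a ℚ.- c) ℚ.* b) ((b ℚ.- d) ℚ.* c) ⟩
    ℚ.∣ (a ℚ.- c) ℚ.* b ∣ ℚ.+ ℚ.∣ (b ℚ.- d) ℚ.* c ∣
      ≡⟨ cong₂ ℚ._+_ (ℚₚ.∣p*q∣≡∣p∣*∣q∣ (a ℚ.- c) b) (ℚₚ.∣p*q∣≡∣p∣*∣q∣ (b ℚ.- d) c) ⟩
    ℚ.∣ a ℚ.- c ∣ ℚ.* ℚ.∣ b ∣ ℚ.+ ℚ.∣ b ℚ.- d ∣ ℚ.* ℚ.∣ c ∣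
      ≤⟨ ℚₚ.+-mono-≤ (*-mono-≤ (ℚₚ.0≤∣p∣ b) 0≤η ac b≤B) (*-mono-≤ (ℚₚ.0≤∣p∣ c) 0≤θ bd c≤A) ⟩
    η ℚ.* B ℚ.+ θ ℚ.* A ∎
    where open ℚₚ.≤-Reasoning

  *-cauchy : ∀ (x y : ℝ) δ → .{{ℚ.Positive δ}} →
    ∃ λ N → ∀ {i j} → N ℕ.≤ i → N ℕ.≤ j →
    ℚ.∣ seq x i ℚ.* seq y i ℚ.- seq x j ℚ.* seq y j ∣ ℚ.≤ δ
  *-cauchy x y δ =
    let A , A>0 , K , x≤A = bounded x
        B , B>0 , L , y≤B = bounded y
        η , η>0 , ηB = scaled (½ ℚ.* δ) B {{half-pos δ}} {{B>0}}
        θ , θ>0 , θA = scaled (½ ℚ.* δ) A {{half-pos δ}} {{A>0}}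
        M , closeˣ = cauchy x η {{η>0}}
        N , closeʸ = cauchy y θ {{θ>0}}
    in (K ℕ.⊔ L) ℕ.⊔ (M ℕ.⊔ N) , λ {i} {j} p q →
    let pKL = ℕₚ.m⊔n≤o⇒m≤o (K ℕ.⊔ L) (M ℕ.⊔ N) p
        qKL = ℕₚ.m⊔n≤o⇒m≤o (K ℕ.⊔ L) (M ℕ.⊔ N) q
        pMN = ℕₚ.m⊔n≤o⇒n≤o (K ℕ.⊔ L) (M ℕ.⊔ N) p
        qMN = ℕₚ.m⊔n≤o⇒n≤o (K ℕ.⊔ L) (M ℕ.⊔ N) q
    in subst (ℚ.∣ seq x i ℚ.* seq y i ℚ.- seq x j ℚ.* seq y j ∣ ℚ.≤_)
         (trans (cong₂ ℚ._+_ ηB θA) (halves δ))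
         (product-close {a = seq x i} {b = seq y i} {c = seq x j} {d = seq y j} {η = η} {θ = θ} {A = A} {B = B}
           (closeˣ (ℕₚ.m⊔n≤o⇒m≤o M N pMN) (ℕₚ.m⊔n≤o⇒m≤o M N qMN))
           (y≤B (ℕₚ.m⊔n≤o⇒n≤o K L pKL))
           (ℚₚ.<⇒≤ (ℚₚ.positive⁻¹ η {{η>0}}))
           (closeʸ (ℕₚ.m⊔n≤o⇒n≤o M N pMN) (ℕₚ.m⊔n≤o⇒n≤o M N qMN))
           (x≤A (ℕₚ.m⊔n≤o⇒m≤o K L qKL))
           (ℚₚ.<⇒≤ (ℚₚ.positive⁻¹ θ {{θ>0}})))

infixl 6 _+ᵣ_
infixl 7 _*ᵣ_

_+ᵣ_ : ℝ → ℝ → ℝ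
(x +ᵣ y) .seq i = seq x i ℚ.+ seq y i
(x +ᵣ y) .cauchy δ
  with cauchy x (½ ℚ.* δ) {{half-pos δ}} | cauchy y (½ ℚ.* δ) {{half-pos δ}}
... | M , closeˣ | N , closeʸ = M ℕ.⊔ N , λ {i} {j} p q → begin
  ℚ.∣ (seq x i ℚ.+ seq y i) ℚ.- (seq x j ℚ.+ seq y j) ∣
    ≡⟨ cong ℚ.∣_∣ (diff-+ (seq x i) (seq y i) (seq x j) (seq y j)) ⟩
  ℚ.∣ (seq x i ℚ.- seq x j) ℚ.+ (seq y i ℚ.- seq y j) ∣
    ≤⟨ ℚₚ.∣p+q∣≤∣p∣+∣q∣ (seq x i ℚ.- seq x j) (seq y i ℚ.- seq y j) ⟩
  ℚ.∣ seq x i ℚ.- seq x j ∣ ℚ.+ ℚ.∣ seq y i ℚ.- seq y j ∣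
    ≤⟨ ℚₚ.+-mono-≤ (closeˣ (ℕₚ.m⊔n≤o⇒m≤o M N p) (ℕₚ.m⊔n≤o⇒m≤o M N q))
                   (closeʸ (ℕₚ.m⊔n≤o⇒n≤o M N p) (ℕₚ.m⊔n≤o⇒n≤o M N q)) ⟩
  ½ ℚ.* δ ℚ.+ ½ ℚ.* δ
    ≡⟨ halves δ ⟩
  δ ∎
  where
  open ℚₚ.≤-Reasoning

_*ᵣ_ : ℝ → ℝ → ℝ
(x *ᵣ y) .seq i = seq x i ℚ.* seq y i
(x *ᵣ y) .cauchy = *-cauchy x y

-- The sequence is shifted by the index from which x is bounded away from 0,
-- so that every term of it is invertible.
recip : (x : ℝ) → 0ᵣ <ᵣ x → ℝ
recip x (β , β>0 , K , β≤x) = mkℝ inv inv-cauchy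
  where
  open ℚₚ.≤-Reasoning

  tail : ℕ → ℚ
  tail i = seq x (K ℕ.+ i)

  β≤ : ∀ i → β ℚ.≤ tail i
  β≤ i = subst (ℚ._≤ tail i) (ℚₚ.+-identityˡ β) (β≤x (ℕₚ.m≤m+n K i))

  0≤β : 0ℚ ℚ.≤ β
  0≤β = ℚₚ.<⇒≤ (ℚₚ.positive⁻¹ β {{β>0}})

  tail>0 : ∀ i → ℚ.Positive (tail i)
  tail>0 i = ℚ.positive (ℚₚ.<-≤-trans (ℚₚ.positive⁻¹ β {{β>0}}) (β≤ i))

  inv : ℕ → ℚ
  inv i = (ℚ.1/ tail i) {{ℚₚ.pos⇒nonZero (tail i) {{tail>0 i}}}}

  invˡ : ∀ i → inv i ℚ.* tail i ≡ 1ℚ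
  invˡ i = ℚₚ.*-inverseˡ (tail i) {{ℚₚ.pos⇒nonZero (tail i) {{tail>0 i}}}}

  inv-cauchy : ∀ δ → .{{ℚ.Positive δ}} →
               ∃ λ N → ∀ {i j} → N ℕ.≤ i → N ℕ.≤ j →
               ℚ.∣ inv i ℚ.- inv j ∣ ℚ.≤ δ
  inv-cauchy δ {{δ>0}}
    with cauchy x (δ ℚ.* (β ℚ.* β))
           {{ℚₚ.pos*pos⇒pos δ (β ℚ.* β) {{ℚₚ.pos*pos⇒pos β {{β>0}} β {{β>0}}}}}}
  ... | N , close = N , λ {i} {j} p q →
    let a = tail i ; b = tail j
        ab>0 = ℚₚ.pos*pos⇒pos a {{tail>0 i}} b {{tail>0 j}}
        0≤ab = ℚₚ.<⇒≤ (ℚₚ.positive⁻¹ (a ℚ.* b) {{ab>0}})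
    in ℚₚ.*-cancelʳ-≤-pos (a ℚ.* b) {{ab>0}} (begin
      ℚ.∣ inv i ℚ.- inv j ∣ ℚ.* (a ℚ.* b)
        ≡⟨ cong (ℚ.∣ inv i ℚ.- inv j ∣ ℚ.*_) (sym (ℚₚ.0≤p⇒∣p∣≡p 0≤ab)) ⟩
      ℚ.∣ inv i ℚ.- inv j ∣ ℚ.* ℚ.∣ a ℚ.* b ∣
        ≡⟨ sym (ℚₚ.∣p*q∣≡∣p∣*∣q∣ (inv i ℚ.- inv j) (a ℚ.* b)) ⟩
      ℚ.∣ (inv i ℚ.- inv j) ℚ.* (a ℚ.* b) ∣
        ≡⟨ cong ℚ.∣_∣ (diff-inv (inv i) (inv j) a b) ⟩
      ℚ.∣ inv i ℚ.* a ℚ.* b ℚ.- inv j ℚ.* b ℚ.* a ∣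
        ≡⟨ cong ℚ.∣_∣ (cong₂ ℚ._-_
            (trans (cong (ℚ._* b) (invˡ i)) (ℚₚ.*-identityˡ b))
            (trans (cong (ℚ._* a) (invˡ j)) (ℚₚ.*-identityˡ a))) ⟩
      ℚ.∣ b ℚ.- a ∣
        ≤⟨ close (ℕₚ.≤-trans q (ℕₚ.m≤n+m j K)) (ℕₚ.≤-trans p (ℕₚ.m≤n+m i K)) ⟩
      δ ℚ.* (β ℚ.* β)
        ≤⟨ ℚₚ.*-monoˡ-≤-nonNeg δ {{ℚₚ.pos⇒nonNeg δ {{δ>0}}}}
            (*-mono-≤ 0≤β (ℚₚ.≤-trans 0≤β (β≤ i)) (β≤ i) (β≤ j)) ⟩
      δ ℚ.* (a ℚ.* b) ∎)

-- Finite graphs of order v have V = Fin v; a general V lets vertex-deleted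
-- subgraphs be graphs too.
record Graph (V : Set) : Set₁ where
  infix 4 _~_
  field
    _~_      : Rel V 0ℓ
    ~-dec    : Decidable _~_
    ~-sym    : Symmetric _~_
    ~-irrefl : Irreflexive _≡_ _~_

module _ {V : Set} (G : Graph V) where
  open Graph G

  Connected : Set
  Connected = ∀ u w → Star _~_ u w

  Complete : Set
  Complete = ∀ {u w} → u ≢ w → u ~ w

  -- c(G) = k: the classes of the connectedness relation are in bijection
  -- with Fin k.
  ComponentCount : ℕ → Set
  ComponentCount k = Σ[ label ∈ (V → Fin k) ]
    (∀ c → ∃ λ u → label u ≡ c) ×
    (∀ u w → label u ≡ label w ⇔ Star _~_ u w)

-- Membership in ∁ S, unlike the function type _∉ S, is proof-irrelevant.
infixl 5 _−_

_−_ : ∀ {v} → Graph (Fin v) → (S : Subset v) → Graph (Σ[ u ∈ Fin v ] u ∈ ∁ S)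
G − S = record
  { _~_      = λ u w → proj₁ u ~ proj₁ w
  ; ~-dec    = λ u w → ~-dec (proj₁ u) (proj₁ w)
  ; ~-sym    = ~-sym
  ; ~-irrefl = λ u≡w → ~-irrefl (cong proj₁ u≡w)
  }
  where open Graph G

IsMinimum : {A : Set} → Rel A 0ℓ → (A → Set) → A → Set
IsMinimum _≤_ P x = P x × (∀ y → P y → x ≤ y)

module _ {v : ℕ} (G : Graph (Fin v)) where

  CutSet : Subset v → Set
  CutSet S = ¬ Connected (G − S)

  -- The second alternative gives κ(Kᵥ) = v − 1.
  IsVertexConnectivity : ℕ → Set
  IsVertexConnectivity = IsMinimum ℕ._≤_ λ k →
    ∃ λ S → (CutSet S ⊎ ∣ ∁ S ∣ ≡ 1) × k ≡ ∣ S ∣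

  -- A disconnected graph has at least one component, so writing the component
  -- count as suc k excludes no cut set.
  IsToughness : ℚ → Set
  IsToughness = IsMinimum ℚ._≤_ λ q →
    ∃₂ λ S k → CutSet S × ComponentCount (G − S) (suc k) × q ≡ + ∣ S ∣ ℚ./ suc k

-- The pairs (u , w) and (w , u) denote the same edge.
Edge : Set → Set
Edge V = V × V

module _ {V : Set} where

  infix 4 _≈ₑ_ _∈ₑ_ _∈ₘ_ _⊆ₘ_

  _≈ₑ_ : Rel (Edge V) 0ℓ
  e ≈ₑ f = e ≡ f ⊎ e ≡ swap f

  _∈ₑ_ : V → Edge V → Set
  u ∈ₑ e = u ≡ proj₁ e ⊎ u ≡ proj₂ e

  Independent : Rel (Edge V) 0ℓ
  Independent e f = ∀ {u} → u ∈ₑ e → ¬ u ∈ₑ f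

  _∈ₘ_ : Edge V → List (Edge V) → Set
  e ∈ₘ M = Any (e ≈ₑ_) M

  _⊆ₘ_ : Rel (List (Edge V)) 0ℓ
  M ⊆ₘ F = ∀ {e} → e ∈ₘ M → e ∈ₘ F

module _ {V : Set} (G : Graph V) where
  open Graph G

  IsMatching : List (Edge V) → Set
  IsMatching M = All (uncurry _~_) M × AllPairs Independent M

  IsMatchingOfSize : ℕ → List (Edge V) → Set
  IsMatchingOfSize k M = IsMatching M × length M ≡ k

  IsPerfectMatching : List (Edge V) → Set
  IsPerfectMatching F = IsMatching F × (∀ u → Any (u ∈ₑ_) F)

infixl 5 _∖_

_∖_ : ∀ {v} → Graph (Fin v) → List (Edge (Fin v)) → Graph (Fin v)
G ∖ N = record
  { _~_      = λ u w → u ~ w × ¬ (u , w) ∈ₘ N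
  ; ~-dec    = λ u w → ~-dec u w ×-dec
      ¬? (any? (λ f → ((u , w) ≟ₑ f) ⊎-dec ((u , w) ≟ₑ swap f)) N)
  ; ~-sym    = λ (u~w , uw∉N) → ~-sym u~w , uw∉N ∘ Any.map flip-edge
  ; ~-irrefl = λ u≡w (u~w , _) → ~-irrefl u≡w u~w
  }
  where
  open Graph G
  _≟ₑ_ = ≡-dec _≟ꟳ_ _≟ꟳ_
  flip-edge : ∀ {u w f} → (w , u) ≈ₑ f → (u , w) ≈ₑ f
  flip-edge (inj₁ eq) = inj₂ (cong swap eq)
  flip-edge (inj₂ eq) = inj₁ (cong swap eq)

record Extendable {v : ℕ} (G : Graph (Fin v)) (m : ℕ) : Set where
  field
    connected       : Connected G
    perfectMatching : ∃ (IsPerfectMatching G)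
    order           : 2 ℕ.* m ℕ.+ 2 ℕ.≤ v
    extend          : ∀ M → IsMatchingOfSize G m M →
                      ∃ λ F → IsPerfectMatching G F × M ⊆ₘ F

record EExtendable {v : ℕ} (G : Graph (Fin v)) (m n : ℕ) : Set where
  field
    connected       : Connected G
    perfectMatching : ∃ (IsPerfectMatching G)
    order           : 2 ℕ.* m ℕ.+ 2 ℕ.* n ℕ.+ 2 ℕ.≤ v
    extend          : ∀ N → IsMatchingOfSize G n N → Extendable (G ∖ N) m

{-# OPTIONS --safe #-}

-- Suppose M lies in no perfect matching of G ∖ N.  By Tutte's theorem some
-- S ⊆ V ∖ V(M) leaves at least |S| + 2 components in (G ∖ N) − T, where
-- T = S ∪ V(M).  Deleting from G also one end of each edge of N, but never an end
-- of some pair a, b lying in different components and not joined by N, gives a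
-- cut set T′ with |T′| ≤ |S| + 2m + n for which G − T′ has c ≥ max(2, |S| + 2 − n)
-- components.  Hence |T′| ≤ c + K with K = 2m + 2n − 2, so toughness gives
-- 1 + ε ≤ 1 + K / c and κ ≤ |T′| ≤ K + c ≤ K + K / ε, a contradiction.

module Submission where

open import Data.Empty using (⊥-elim)
open import Data.Fin as Fin using (Fin; zero; suc; punchOut)
import Data.Fin.Properties as Finₚ
open import Data.Fin.Subset as Subset using (Subset; ∁; ∣_∣; ⁅_⁆; _∪_; ⋃; ⊤; ⊥)
import Data.Fin.Subset.Properties as Subsetₚ
import Data.Integer as ℤ
import Data.Integer.Properties as ℤₚ
open import Data.List using (List; []; _∷_; _++_; length; filter; cartesianProduct; map; lookup; allFin)
open import Data.List.Membership.Propositional using (_∈_; _∉_; lose; find)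
open import Data.List.Membership.Propositional.Properties
  using (∈-++⁺ˡ; ∈-++⁺ʳ; ∈-++⁻; ∈-filter⁺; ∈-filter⁻; ∈-cartesianProduct⁺; ∈-map⁺; ∈-map⁻;
         ∈-lookup; ∈-allFin; ∈-AllPairs₂)
open import Data.List.Properties
  using (filter-accept; filter-reject; filter-notAll; length-++; ++-assoc; length-map; length-tabulate)
open import Data.List.Relation.Binary.Permutation.Propositional
open import Data.List.Relation.Binary.Permutation.Propositional.Properties
  using (All-resp-↭; Any-resp-↭; ∈-resp-↭; ↭-length; ++⁺ˡ; ++⁺ʳ; shift; shifts; filter-↭; ++-comm)
import Data.List.Relation.Binary.Permutation.Setoid.Properties as Permutationₛ
open import Data.List.Relation.Unary.All as All using (All; []; _∷_; all?)
import Data.List.Relation.Unary.All.Properties as Allₚ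
open import Data.List.Relation.Unary.AllPairs as AllPairs using (AllPairs; []; _∷_)
open import Data.List.Relation.Unary.Any as Any using (Any; here; there; any?)
import Data.List.Relation.Unary.Any.Properties as Anyₚ
open import Data.List.Relation.Unary.Unique.Propositional using (Unique)
open import Data.List.Relation.Unary.Unique.Propositional.Properties using (allFin⁺)
open import Data.Nat as ℕ using (ℕ; zero; suc; _+_; _*_; _∸_; _≤_; _<_; s≤s; z≤n; _≤?_)
open import Data.Nat.Divisibility using (_∣_; divides-refl; ∣m+n∣m⇒∣n; ∣1⇒≡1)
open import Data.Nat.Induction using (<-wellFounded)
import Data.Nat.Properties as ℕₚ
import Data.Nat.Solver as ℕ-Solver
open import Data.Product using (_×_; _,_; ∃; ∃₂; Σ-syntax; proj₁; proj₂; uncurry; map₂; -,_)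
  renaming (swap to flip)
open import Data.Product.Properties using (≡-dec; Σ-≡,≡→≡)
open import Data.Rational as ℚ using (ℚ; 0ℚ; 1ℚ; ½)
import Data.Rational.Properties as ℚₚ
import Data.Rational.Solver as ℚ-Solver
import Data.Rational.Unnormalised as ℚᵘ
import Data.Rational.Unnormalised.Properties as ℚᵘₚ
open import Data.Sum as Sum using (_⊎_; inj₁; inj₂; [_,_]′)
open import Data.Sum.Properties using (inj₁-injective; inj₂-injective)
open import Data.Vec using ([]; _∷_)
open import Data.Vec.Properties.WithK using ([]=-irrelevant)
open import Function using (_∘_; id; case_of_; mk⇔; Equivalence)
open import Induction.WellFounded using (Acc; acc)
open import Level using (0ℓ)
open import Relation.Binary using (Rel; Decidable; DecidableEquality; Symmetric; tri<; tri≈; tri>)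
open import Relation.Binary.Construct.Closure.ReflexiveTransitive as Star using (Star; _◅_; _◅◅_)
open import Relation.Binary.PropositionalEquality as ≡ using (_≡_; _≢_; cong; cong₂; subst)
open import Relation.Nullary using (¬_; Dec; yes; no)
open import Relation.Nullary.Decidable using (_⊎-dec_; _×-dec_; ¬?; decidable-stable)
open import Defs

-- Tutte's theorem

-- Toughness speaks of `G`, whereas Tutte's theorem yields components of `G ∖ N`, and restoring the
-- edges of `N` could merge them. Deleting one end of each such edge prevents this, but every
-- deleted end enlarges the cut by one and may also wipe out one component. An edge of `N` therefore
-- costs 2, as much as the two deleted ends of an edge of `M`; this gives the symmetric 2m + 2n in
-- `K`. The final -2 is the surplus in Tutte's theorem, which parity raises from 1 to 2.
--
-- If Tutte's theorem leaves only a few components, these deletions might leave a single one, and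
-- toughness says nothing about sets that do not cut. This is the purpose of the spared pair.
-- Finding that pair may take a third vertex outside `T`, so a lower bound on the order of `G` has
-- to come first; it is extracted from toughness as well.
--
-- The real numbers are confined to the end: their outcome is the integral inequality `tough`, and
-- the combinatorial argument runs on that alone.

module _ {A : Set} where

  AllPairs-resp-↭ : {P : Rel A 0ℓ} {xs ys : List A} → Symmetric P → xs ↭ ys → AllPairs P xs → AllPairs P ys
  AllPairs-resp-↭ {P} Psym p = Permutationₛ.AllPairs-resp-↭ (≡.setoid A) Psym (≡.resp₂ P) (↭⇒↭ₛ p)

  Unique-resp-↭ : {xs ys : List A} → xs ↭ ys → Unique xs → Unique ys
  Unique-resp-↭ = AllPairs-resp-↭ (_∘ ≡.sym)

  AllPairs-map∈ : {P Q : Rel A 0ℓ} {xs : List A} →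
    (∀ {x y} → x ∈ xs → y ∈ xs → P x y → Q x y) → AllPairs P xs → AllPairs Q xs
  AllPairs-map∈ f [] = []
  AllPairs-map∈ f (px ∷ pxs) =
    All.tabulate (λ y∈ → f (here ≡.refl) (there y∈) (All.lookup px y∈)) ∷
    AllPairs-map∈ (λ x∈ y∈ → f (there x∈) (there y∈)) pxs

  Any⇒↭ : {P : A → Set} {xs : List A} → Any P xs → ∃₂ λ x ys → P x × xs ↭ x ∷ ys
  Any⇒↭ {xs = x ∷ xs} (here px) = x , xs , px , refl
  Any⇒↭ {xs = x ∷ xs} (there p) =
    let y , ys , py , xs↭ = Any⇒↭ p
    in y , x ∷ ys , py , trans (prep x xs↭) (swap x y refl)

  Unique-++⇒≢ : ∀ {xs ys : List A} {x y} → Unique (xs ++ ys) → x ∈ xs → y ∈ ys → x ≢ y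
  Unique-++⇒≢ {_ ∷ xs} (x∉ ∷ _) (here ≡.refl) y∈ = All.lookup x∉ (∈-++⁺ʳ xs y∈)
  Unique-++⇒≢ (_ ∷ u) (there x∈) y∈ = Unique-++⇒≢ u x∈ y∈

  Unique-++⇒ʳ : ∀ xs {ys : List A} → Unique (xs ++ ys) → Unique ys
  Unique-++⇒ʳ []       u       = u
  Unique-++⇒ʳ (_ ∷ xs) (_ ∷ u) = Unique-++⇒ʳ xs u

  Unique-++⇒ˡ : ∀ {xs ys : List A} → Unique (xs ++ ys) → Unique xs
  Unique-++⇒ˡ {xs} {ys} u = Unique-++⇒ʳ ys (Unique-resp-↭ (++-comm xs ys) u)

module _ {A : Set} where

  ≈ₑ-sym : {e f : Edge A} → e ≈ₑ f → f ≈ₑ e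
  ≈ₑ-sym (inj₁ ≡.refl) = inj₁ ≡.refl
  ≈ₑ-sym (inj₂ ≡.refl) = inj₂ ≡.refl

  ≈ₑ-trans : {e f g : Edge A} → e ≈ₑ f → f ≈ₑ g → e ≈ₑ g
  ≈ₑ-trans (inj₁ ≡.refl) f≈g           = f≈g
  ≈ₑ-trans (inj₂ ≡.refl) (inj₁ ≡.refl) = inj₂ ≡.refl
  ≈ₑ-trans (inj₂ ≡.refl) (inj₂ ≡.refl) = inj₁ ≡.refl

  ≈ₑ-swap : {x y : A} → (x , y) ≈ₑ (y , x)
  ≈ₑ-swap = inj₂ ≡.refl

  ∈ₘ-swap : ∀ {x y : A} {M} → (x , y) ∈ₘ M → (y , x) ∈ₘ M
  ∈ₘ-swap = Any.map (≈ₑ-trans ≈ₑ-swap)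

  vertices : List (Edge A) → List A
  vertices []            = []
  vertices ((x , y) ∷ M) = x ∷ y ∷ vertices M

  vertices-++ : ∀ M N → vertices (M ++ N) ≡ vertices M ++ vertices N
  vertices-++ []            N = ≡.refl
  vertices-++ ((x , y) ∷ M) N = cong (λ vs → x ∷ y ∷ vs) (vertices-++ M N)

  length-vertices : ∀ M → length (vertices M) ≡ length M * 2
  length-vertices []      = ≡.refl
  length-vertices (_ ∷ M) = cong (2 +_) (length-vertices M)

  vertices-↭ : ∀ {M N} → M ↭ N → vertices M ↭ vertices N
  vertices-↭ refl = refl
  vertices-↭ (prep (x , y) p) = prep x (prep y (vertices-↭ p))
  vertices-↭ (swap (x , y) (z , w) p) =
    trans (shifts (x ∷ y ∷ []) (z ∷ w ∷ [])) (++⁺ˡ (z ∷ w ∷ x ∷ y ∷ []) (vertices-↭ p))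
  vertices-↭ (trans p q) = trans (vertices-↭ p) (vertices-↭ q)

  vertices-≈ₑ : ∀ {x y e} M → (x , y) ≈ₑ e → vertices (e ∷ M) ↭ x ∷ y ∷ vertices M
  vertices-≈ₑ M (inj₁ ≡.refl) = refl
  vertices-≈ₑ M (inj₂ ≡.refl) = swap _ _ refl

  ∈ₘ⇒∈-vertices : ∀ {x y M} → (x , y) ∈ₘ M → x ∈ vertices M
  ∈ₘ⇒∈-vertices (here (inj₁ ≡.refl)) = here ≡.refl
  ∈ₘ⇒∈-vertices (here (inj₂ ≡.refl)) = there (here ≡.refl)
  ∈ₘ⇒∈-vertices (there p)            = there (there (∈ₘ⇒∈-vertices p))

  ∈-vertices⇒Any : ∀ {x M} → x ∈ vertices M → Any (λ e → ∃ λ y → (x , y) ≈ₑ e) M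
  ∈-vertices⇒Any {M = _ ∷ _} (here ≡.refl)         = here (-, inj₁ ≡.refl)
  ∈-vertices⇒Any {M = _ ∷ _} (there (here ≡.refl)) = here (-, inj₂ ≡.refl)
  ∈-vertices⇒Any {M = _ ∷ _} (there (there p))     = there (∈-vertices⇒Any p)

  partner : ∀ {x M} → x ∈ vertices M → ∃₂ λ y e → ∃ λ M′ → (x , y) ≈ₑ e × M ↭ e ∷ M′
  partner x∈ = let e , M′ , (y , xy≈e) , M↭ = Any⇒↭ (∈-vertices⇒Any x∈)
               in y , e , M′ , xy≈e , M↭

  -- A single permutation expresses both that the edges cover `V` and, when `V` has no repetitions,
  -- that they are pairwise disjoint.
  Matchable : Rel A 0ℓ → List A → Set
  Matchable R V = ∃ λ M → All (uncurry R) M × vertices M ↭ V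

  Within : Rel A 0ℓ → List A → Rel A 0ℓ
  Within R W x y = x ∈ W × y ∈ W × R x y

  -- Tutte's obstruction: `U` holds representatives of distinct components outside `S`, and `Z` is
  -- everything else there. Whether a component is odd is not recorded, because toughness counts all
  -- components alike.
  record Barrier (R : Rel A 0ℓ) (V : List A) : Set where
    field
      S U Z : List A
      split : S ++ U ++ Z ↭ V
      large : 2 + length S ≤ length U
      apart : AllPairs (λ x y → ¬ Star (Within R (U ++ Z)) x y) U

  -- Fewer edges mean fewer paths. This carries a barrier found after adding an edge back to the
  -- original relation.
  Barrier-mono : ∀ {R R′ V} → (∀ {x y} → R x y → R′ x y) → Barrier R′ V → Barrier R V
  Barrier-mono f B = record
    { Barrier B
    ; apart = AllPairs.map (_∘ Star.map (map₂ (map₂ f))) (Barrier.apart B) }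

  ≈ₑ⇒ : ∀ {R : Rel A 0ℓ} → Symmetric R → ∀ {x y e} → (x , y) ≈ₑ e → uncurry R e → R x y
  ≈ₑ⇒ Rsym (inj₁ ≡.refl) r = r
  ≈ₑ⇒ Rsym (inj₂ ≡.refl) r = Rsym r

2∤1+n*2 : ∀ n → ¬ (2 ∣ suc (n * 2))
2∤1+n*2 n d = case ∣1⇒≡1 (∣m+n∣m⇒∣n (subst (2 ∣_) (ℕₚ.+-comm 1 (n * 2)) d) (divides-refl n)) of λ ()

-- A difference of exactly 1 would make the sum odd. This is the source of the surplus 2 in
-- `Barrier`.
<∧even⇒2+≤ : ∀ {m n} → m < n → 2 ∣ n + m → 2 + m ≤ n
<∧even⇒2+≤ {m} m<n d with ℕₚ.m≤n⇒m<n∨m≡n m<n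
... | inj₁ lt     = lt
... | inj₂ ≡.refl = ⊥-elim (2∤1+n*2 m (subst (λ k → 2 ∣ suc k)
        (≡.trans (cong (m +_) (≡.sym (ℕₚ.+-identityʳ m))) (ℕₚ.*-comm 2 m)) d))

module _ {A : Set} (_≟_ : DecidableEquality A) where

  _≈ₑ?_ : Decidable (_≈ₑ_ {A})
  e ≈ₑ? f = ≡-dec _≟_ _≟_ e f ⊎-dec ≡-dec _≟_ _≟_ e (flip f)

  -- A matching missing only b and h is turned into one missing only b and
  -- another vertex by exchanging an edge at the M₁-partner of h.  Every exchange
  -- adds an edge of M₁ and destroys none, so the process stops.
  module _ {R : Rel A 0ℓ} (Rsym : Symmetric R) {V : List A} (V! : Unique V)
           {M₁ : List (Edge A)} (M₁↭V : vertices M₁ ↭ V) {b : A}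
           (usable : ∀ {h x} → (h , x) ∈ₘ M₁ → R h x ⊎ R b h) where

    private
      ∉M₁? : (e : Edge A) → Dec (¬ (e ∈ₘ M₁))
      ∉M₁? e = ¬? (any? (e ≈ₑ?_) M₁)

      defect : List (Edge A) → ℕ
      defect M = length (filter ∉M₁? M)

    augment : ∀ M {h} → All (uncurry R) M → b ∷ h ∷ vertices M ↭ V →
              Acc _<_ (defect M) → Matchable R V
    augment M {h} RM M↭V (acc rec)
      with x , f , M₁′ , hx≈f , M₁↭ ← partner {x = h} {M = M₁}
             (∈-resp-↭ (trans M↭V (↭-sym M₁↭V)) (there (here ≡.refl)))
      with usable (Any-resp-↭ (↭-sym M₁↭) (here hx≈f))
    ... | inj₂ Rbh = (b , h) ∷ M , Rbh ∷ RM , M↭V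
    ... | inj₁ Rhx with x ≟ b
    ...   | yes ≡.refl = (h , b) ∷ M , Rhx ∷ RM , trans (swap h b refl) M↭V
    ...   | no x≢b
      with hx! ← Unique-resp-↭ (trans (↭-sym M₁↭V) (trans (vertices-↭ M₁↭) (vertices-≈ₑ M₁′ hx≈f))) V!
      with ∈-resp-↭ (↭-sym M↭V) (∈-resp-↭ M₁↭V
             (∈ₘ⇒∈-vertices (∈ₘ-swap (Any-resp-↭ (↭-sym M₁↭) (here hx≈f)))))
         | hx! | Unique-resp-↭ (↭-sym M↭V) V!
    ... | here x≡b | _ | _ = ⊥-elim (x≢b x≡b)
    ... | there (here x≡h) | (h≢x ∷ _) ∷ _ | _ = ⊥-elim (h≢x (≡.sym x≡h))
    ... | there (there x∈M) | (h≢x ∷ _) ∷ x∉M₁′ ∷ _ | _ ∷ h∉M ∷ _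
      with y , e , M′ , xy≈e , M↭ ← partner x∈M
      = augment ((h , x) ∷ M′) {y} (Rhx ∷ All.tail (All-resp-↭ M↭ RM)) M″↭V
          (rec (≡.subst₂ _<_ (cong length (≡.sym (filter-reject ∉M₁? (λ ∉M₁ → ∉M₁ hx∈M₁))))
                 (≡.trans (cong length (≡.sym (filter-accept ∉M₁? e∉M₁)))
                          (↭-length (filter-↭ ∉M₁? (↭-sym M↭))))
                 (ℕₚ.n<1+n _)))
      where
      hx∈M₁ = Any-resp-↭ (↭-sym M₁↭) (here hx≈f)
      vM↭ : vertices M ↭ x ∷ y ∷ vertices M′
      vM↭ = trans (vertices-↭ M↭) (vertices-≈ₑ M′ xy≈e)
      M″↭V : b ∷ y ∷ h ∷ x ∷ vertices M′ ↭ V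
      M″↭V = trans (prep b (trans (↭-sym (shift y (h ∷ x ∷ []) _)) (prep h (↭-sym vM↭)))) M↭V
      y≢h : y ≢ h
      y≢h y≡h = All.lookup h∉M (∈-resp-↭ (↭-sym vM↭) (there (here ≡.refl))) (≡.sym y≡h)
      -- The edge of `M₁` at `x` leads to `h`, and `y` is not `h`; hence the discarded edge at `x`
      -- is not in `M₁` and the defect drops.
      e∉M₁ : ¬ (e ∈ₘ M₁)
      e∉M₁ e∈ with Any-resp-↭ M₁↭ (Any.map (≈ₑ-trans xy≈e) e∈)
      ... | there xy∈M₁′ = All.lookup x∉M₁′ (∈ₘ⇒∈-vertices xy∈M₁′) ≡.refl
      ... | here xy≈f with ≈ₑ-trans xy≈f (≈ₑ-sym hx≈f)
      ...   | inj₁ ≡.refl = h≢x ≡.refl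
      ...   | inj₂ ≡.refl = y≢h ≡.refl

  module _ {R : Rel A 0ℓ} (R? : Decidable R) (Rsym : Symmetric R) where

    -- Each new vertex either takes a leftover neighbour or becomes a leftover itself, so the
    -- leftovers stay independent. Such a maximal matching suffices below, where the components are
    -- cliques and hence keep at most one leftover each.
    greedy : ∀ W → ∃₂ λ M U → All (uncurry R) M × AllPairs (λ x y → ¬ R x y) U × vertices M ++ U ↭ W
    greedy [] = [] , [] , [] , [] , refl
    greedy (x ∷ W) with M , U , RM , ¬RU , MU↭W ← greedy W with any? (R? x) U
    ... | no ¬Rx = M , x ∷ U , RM , All.tabulate (λ y∈ Rxy → ¬Rx (lose y∈ Rxy)) ∷ ¬RU ,
          trans (shift x (vertices M) U) (prep x MU↭W)
    ... | yes Rx =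
      let u , U′ , Rxu , U↭ = Any⇒↭ Rx
      in  (x , u) ∷ M , U′ , Rxu ∷ RM , AllPairs.tail (AllPairs-resp-↭ (_∘ Rsym) U↭ ¬RU) ,
          prep x (trans (↭-sym (trans (++⁺ˡ (vertices M) U↭) (shift u (vertices M) U′))) MU↭W)

  module _ {R : Rel A 0ℓ} where

    -- Each vertex of `U` uses up one vertex of `S`; by parity an even number of vertices of `S`
    -- remains, and these are paired among themselves.
    saturate : ∀ U S → length U ≤ length S → 2 ∣ length U + length S →
               AllPairs R S → All (λ u → All (R u) S) U → Matchable R (U ++ S)
    saturate [] [] _ _ _ _ = [] , [] , refl
    saturate [] (_ ∷ []) _ 2∣1 _ _ = case ∣1⇒≡1 2∣1 of λ ()
    saturate [] (s ∷ s′ ∷ S) _ 2∣ ((Rss′ ∷ _) ∷ _ ∷ RS) _ =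
      let M , RM , M↭ = saturate [] S z≤n (∣m+n∣m⇒∣n 2∣ (divides-refl 1)) RS []
      in  (s , s′) ∷ M , Rss′ ∷ RM , prep s (prep s′ M↭)
    saturate (u ∷ U) (s ∷ S) (s≤s U≤S) 2∣ (_ ∷ RS) ((Rus ∷ _) ∷ RUS) =
      let M , RM , M↭ = saturate U S U≤S
            (∣m+n∣m⇒∣n (subst (λ k → 2 ∣ suc k) (ℕₚ.+-suc (length U) (length S)) 2∣) (divides-refl 1))
            RS (All.map All.tail RUS)
      in  (u , s) ∷ M , Rus ∷ RM , prep u (trans (prep s M↭) (↭-sym (shift s U S)))

  module _ {R : Rel A 0ℓ} (R? : Decidable R) (Rsym : Symmetric R) {V : List A}
           (V! : Unique V) (2∣V : 2 ∣ length V) where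

    -- S is joined to everything, and adjacency outside S is transitive, so the
    -- vertices missed by a greedy matching outside S lie in distinct components.
    transitive-case : ∀ S W → S ++ W ↭ V →
      (∀ {s y} → s ∈ S → y ∈ V → s ≢ y → R s y) →
      (∀ {x y z} → x ∈ W → y ∈ W → z ∈ W → R x y → R y z → x ≡ z ⊎ R x z) →
      Matchable R V ⊎ Barrier R V
    transitive-case S W SW↭V joined tr
      with M , U , RM , ¬RU , MU↭W ← greedy R? Rsym W = compare (length U ≤? length S)
      where
      MUS↭V : vertices M ++ U ++ S ↭ V
      MUS↭V = trans (↭-reflexive (≡.sym (++-assoc (vertices M) U S)))
                (trans (++⁺ʳ S MU↭W) (trans (++-comm W S) SW↭V))
      US! : Unique (U ++ S)
      US! = Unique-++⇒ʳ (vertices M) (Unique-resp-↭ (↭-sym MUS↭V) V!)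
      ∈V : ∀ {x} → x ∈ U ++ S → x ∈ V
      ∈V x∈ = ∈-resp-↭ MUS↭V (∈-++⁺ʳ (vertices M) x∈)
      2∣US : 2 ∣ length U + length S
      2∣US = ∣m+n∣m⇒∣n (subst (2 ∣_) V≡ 2∣V) (divides-refl (length M))
        where
        V≡ : length V ≡ length M * 2 + (length U + length S)
        V≡ = ≡.trans (↭-length (↭-sym MUS↭V)) (≡.trans (length-++ (vertices M))
               (≡.cong₂ _+_ (length-vertices M) (length-++ U)))
      RS : AllPairs R S
      RS = AllPairs-map∈ (λ s∈ t∈ → joined s∈ (∈V (∈-++⁺ʳ U t∈))) (Unique-++⇒ʳ U US!)
      RUS : All (λ u → All (R u) S) U
      RUS = All.tabulate λ u∈ → All.tabulate λ s∈ →
        Rsym (joined s∈ (∈V (∈-++⁺ˡ u∈)) (Unique-++⇒≢ US! u∈ s∈ ∘ ≡.sym))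
      UM↭W : U ++ vertices M ↭ W
      UM↭W = trans (++-comm U (vertices M)) MU↭W
      -- By transitivity a whole path outside `S` collapses to one edge, unless it returns to its
      -- start.
      adjacent : ∀ {x y} → y ∈ U ++ vertices M → Star (Within R (U ++ vertices M)) x y → x ≡ y ⊎ R x y
      adjacent y∈ Star.ε = inj₁ ≡.refl
      adjacent z∈ ((x∈ , y∈ , Rxy) ◅ path) with adjacent z∈ path
      ... | inj₁ ≡.refl = inj₂ Rxy
      ... | inj₂ Ryz    = tr (∈-resp-↭ UM↭W x∈) (∈-resp-↭ UM↭W y∈) (∈-resp-↭ UM↭W z∈) Rxy Ryz
      compare : Dec (length U ≤ length S) → Matchable R V ⊎ Barrier R V
      compare (yes U≤S) =
        let M′ , RM′ , M′↭ = saturate U S U≤S 2∣US RS RUS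
        in  inj₁ (M ++ M′ , Allₚ.++⁺ RM RM′ ,
              trans (↭-reflexive (vertices-++ M M′)) (trans (++⁺ˡ (vertices M) M′↭) MUS↭V))
      compare (no U≰S) = inj₂ record
        { S = S ; U = U ; Z = vertices M
        ; split = trans (++⁺ˡ S UM↭W) SW↭V
        ; large = <∧even⇒2+≤ (ℕₚ.≰⇒> U≰S) 2∣US
        ; apart = AllPairs-map∈ (λ x∈ y∈ (x≢y , ¬Rxy) → [ x≢y , ¬Rxy ]′ ∘ adjacent (∈-++⁺ˡ y∈))
            (AllPairs.zip (Unique-++⇒ˡ US! , ¬RU))
        }

  Joined : Rel A 0ℓ → List A → A → Set
  Joined R V s = All (λ y → s ≡ y ⊎ R s y) V

  module _ {V : List A} (V! : Unique V) (2∣V : 2 ∣ length V) where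

    -- Lovász's proof of Tutte's theorem, by induction on the number of
    -- non-edges; L lists (at least) the non-edges inside V.
    tutte-aux : ∀ {R} → Decidable R → Symmetric R → ∀ L →
      (∀ {x y} → x ∈ V → y ∈ V → R x y ⊎ (x , y) ∈ L) →
      Acc _<_ (length L) → Matchable R V ⊎ Barrier R V
    tutte-aux {R} R? Rsym L cover (acc rec) = search (any? (λ b → any? (λ a → any? (bad? b a) W) W) W)
      where
      joined? : ∀ s → Dec (Joined R V s)
      joined? s = all? (λ y → (s ≟ y) ⊎-dec R? s y) V
      S = filter joined? V
      W = filter (¬? ∘ joined?) V

      Bad : A → A → A → Set
      Bad b a c = R a b × R b c × a ≢ c × ¬ R a c
      bad? : ∀ b a c → Dec (Bad b a c)
      bad? b a c = R? a b ×-dec R? b c ×-dec ¬? (a ≟ c) ×-dec ¬? (R? a c)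

      with-edge : ∀ {x y} → x ∈ V → y ∈ V → ¬ R x y →
        Matchable (λ u w → R u w ⊎ (u , w) ≈ₑ (x , y)) V ⊎ Barrier R V
      with-edge {x} {y} x∈ y∈ ¬Rxy = Sum.map₂ (Barrier-mono inj₁)
        (tutte-aux R⁺? (Sum.map Rsym (≈ₑ-trans ≈ₑ-swap)) (filter (¬? ∘ uncurry R⁺?) L) cover⁺
          (rec (filter-notAll (¬? ∘ uncurry R⁺?) L
            (lose xy∈L (λ ¬R⁺ → ¬R⁺ (inj₂ (inj₁ ≡.refl)))))))
        where
        R⁺? : Decidable (λ u w → R u w ⊎ (u , w) ≈ₑ (x , y))
        R⁺? u w = R? u w ⊎-dec ((u , w) ≈ₑ? (x , y))
        xy∈L : (x , y) ∈ L
        xy∈L = [ ⊥-elim ∘ ¬Rxy , id ]′ (cover x∈ y∈)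
        cover⁺ : ∀ {u w} → u ∈ V → w ∈ V →
          (R u w ⊎ (u , w) ≈ₑ (x , y)) ⊎ (u , w) ∈ filter (¬? ∘ uncurry R⁺?) L
        cover⁺ {u} {w} u∈ w∈ with R⁺? u w
        ... | yes R⁺uw = inj₁ R⁺uw
        ... | no ¬R⁺uw with cover u∈ w∈
        ...   | inj₁ Ruw  = ⊥-elim (¬R⁺uw (inj₁ Ruw))
        ...   | inj₂ uw∈L = inj₂ (∈-filter⁺ (¬? ∘ uncurry R⁺?) uw∈L ¬R⁺uw)

      -- Takes the place of following the symmetric difference of the two matchings. Without `b d`,
      -- the second matching misses only `b` and `d`, and `augment` repairs it along the first. The
      -- only edge of `M₁` that may be absent from `R` is `a c`, and both of its ends are neighbours
      -- of `b`, so meeting it finishes the repair.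
      combine : ∀ {a b c d} → R a b → R b c →
        Matchable (λ u w → R u w ⊎ (u , w) ≈ₑ (a , c)) V →
        Matchable (λ u w → R u w ⊎ (u , w) ≈ₑ (b , d)) V → Matchable R V
      combine {a} {b} {c} {d} Rab Rbc (M₁ , R⁺M₁ , M₁↭V) (M₂ , R⁺M₂ , M₂↭V)
        with any? ((b , d) ≈ₑ?_) M₂
      ... | no bd∉M₂ = M₂ , All.tabulate only-R , M₂↭V
        where
        only-R : ∀ {e} → e ∈ M₂ → uncurry R e
        only-R e∈ = [ id , (λ e≈bd → ⊥-elim (bd∉M₂ (lose e∈ (≈ₑ-sym e≈bd)))) ]′ (All.lookup R⁺M₂ e∈)
      ... | yes bd∈M₂ with e , M , bd≈e , M₂↭ ← Any⇒↭ bd∈M₂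
        = augment Rsym V! M₁↭V usable M RM M↭V (<-wellFounded _)
        where
        M↭V : b ∷ d ∷ vertices M ↭ V
        M↭V = trans (↭-sym (trans (vertices-↭ M₂↭) (vertices-≈ₑ M bd≈e))) M₂↭V
        only-R : ∀ {f} → f ∈ M → uncurry R f
        only-R f∈ with All.lookup (All-resp-↭ M₂↭ R⁺M₂) (there f∈) | Unique-resp-↭ (↭-sym M↭V) V!
        ... | inj₁ Rf   | _ = Rf
        ... | inj₂ f≈bd | b∉ ∷ _ =
          ⊥-elim (All.lookup b∉ (there (∈ₘ⇒∈-vertices (lose f∈ (≈ₑ-sym f≈bd)))) ≡.refl)
        RM : All (uncurry R) M
        RM = All.tabulate only-R
        usable : ∀ {h x} → (h , x) ∈ₘ M₁ → R h x ⊎ R b h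
        usable hx∈ with find hx∈
        ... | f , f∈ , hx≈f with All.lookup R⁺M₁ f∈
        ...   | inj₁ Rf = inj₁ (≈ₑ⇒ Rsym hx≈f Rf)
        ...   | inj₂ f≈ac with ≈ₑ-trans hx≈f f≈ac
        ...     | inj₁ ≡.refl = inj₂ (Rsym Rab)
        ...     | inj₂ ≡.refl = inj₂ Rbc

      search : Dec (Any (λ b → Any (λ a → Any (Bad b a) W) W) W) → Matchable R V ⊎ Barrier R V
      search (no ¬bad) = transitive-case R? Rsym V! 2∣V S W (↭-sym (filter-split V)) joined tr
        where
        filter-split : ∀ xs → xs ↭ filter joined? xs ++ filter (¬? ∘ joined?) xs
        filter-split [] = refl
        filter-split (x ∷ xs) with joined? x
        ... | yes _ = prep x (filter-split xs)
        ... | no _  = trans (prep x (filter-split xs)) (↭-sym (shift x (filter joined? xs) _))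
        joined : ∀ {s y} → s ∈ S → y ∈ V → s ≢ y → R s y
        joined s∈ y∈ s≢y =
          [ ⊥-elim ∘ s≢y , id ]′ (All.lookup (proj₂ (∈-filter⁻ joined? {xs = V} s∈)) y∈)
        tr : ∀ {x y z} → x ∈ W → y ∈ W → z ∈ W → R x y → R y z → x ≡ z ⊎ R x z
        tr {x} {y} {z} x∈ y∈ z∈ Rxy Ryz with x ≟ z | R? x z
        ... | yes x≡z | _ = inj₁ x≡z
        ... | no _    | yes Rxz = inj₂ Rxz
        ... | no x≢z  | no ¬Rxz = ⊥-elim (¬bad (lose y∈ (lose x∈ (lose z∈ (Rxy , Ryz , x≢z , ¬Rxz)))))
      search (yes bad)
        with b , b∈W , badᵇ ← find bad
        with a , a∈W , badᵃ ← find badᵇ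
        with c , c∈W , Rab , Rbc , a≢c , ¬Rac ← find badᵃ
        with b∈V , ¬joined ← ∈-filter⁻ (¬? ∘ joined?) {xs = V} b∈W
        -- As `b` is outside `S`, it has a non-neighbour `d` other than itself: the second edge to
        -- be added.
        with d , d∈V , ¬bd ← find (Allₚ.¬All⇒Any¬ (λ y → (b ≟ y) ⊎-dec R? b y) V ¬joined)
        with with-edge (W⊆V a∈W) (W⊆V c∈W) ¬Rac | with-edge b∈V d∈V (¬bd ∘ inj₂)
        where
        W⊆V : ∀ {x} → x ∈ W → x ∈ V
        W⊆V x∈ = proj₁ (∈-filter⁻ (¬? ∘ joined?) {xs = V} x∈)
      ... | inj₂ B  | _       = inj₂ B
      ... | inj₁ _  | inj₂ B  = inj₂ B
      ... | inj₁ P₁ | inj₁ P₂ = inj₁ (combine Rab Rbc P₁ P₂)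

    tutte : ∀ {R} → Decidable R → Symmetric R → Matchable R V ⊎ Barrier R V
    tutte R? Rsym = tutte-aux R? Rsym (cartesianProduct V V)
      (λ x∈ y∈ → inj₂ (∈-cartesianProduct⁺ x∈ y∈)) (<-wellFounded _)

-- Components

AllPairs-lookup : ∀ {A : Set} {P : Rel A 0ℓ} {xs} → AllPairs P xs →
  ∀ {i j} → i Fin.< j → P (lookup xs i) (lookup xs j)
AllPairs-lookup {xs = _ ∷ xs} (px ∷ _) {zero} {suc j} _ = All.lookup px (∈-lookup {xs = xs} j)
AllPairs-lookup (_ ∷ pxs) {suc i} {suc j} (s≤s i<j) = AllPairs-lookup pxs i<j

Unique-⊆⇒↭ : ∀ {A : Set} {xs ys : List A} → Unique xs → (∀ {x} → x ∈ xs → x ∈ ys) →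
  ∃ λ zs → ys ↭ xs ++ zs
Unique-⊆⇒↭ {ys = ys} [] _ = ys , refl
Unique-⊆⇒↭ {xs = x ∷ xs} {ys} (x∉ ∷ xs!) xs⊆
  with _ , ys′ , ≡.refl , ys↭ ← Any⇒↭ (xs⊆ (here ≡.refl))
  with zs , ys′↭ ← Unique-⊆⇒↭ xs! (λ {y} y∈ → [ (λ { ≡.refl → ⊥-elim (All.lookup x∉ y∈ ≡.refl) }) , id ]′
         (Any.toSum (∈-resp-↭ ys↭ (xs⊆ (there y∈)))))
  = zs , trans ys↭ (prep x ys′↭)

∣p∪q∣≤∣p∣+∣q∣ : ∀ {v} (p q : Subset v) → ∣ p ∪ q ∣ ≤ ∣ p ∣ + ∣ q ∣
∣p∪q∣≤∣p∣+∣q∣ [] [] = z≤n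
∣p∪q∣≤∣p∣+∣q∣ (Subset.outside ∷ p) (Subset.outside ∷ q) = ∣p∪q∣≤∣p∣+∣q∣ p q
∣p∪q∣≤∣p∣+∣q∣ (Subset.outside ∷ p) (Subset.inside ∷ q) =
  ℕₚ.≤-trans (s≤s (∣p∪q∣≤∣p∣+∣q∣ p q)) (ℕₚ.≤-reflexive (≡.sym (ℕₚ.+-suc ∣ p ∣ ∣ q ∣)))
∣p∪q∣≤∣p∣+∣q∣ (Subset.inside ∷ p) (Subset.outside ∷ q) = s≤s (∣p∪q∣≤∣p∣+∣q∣ p q)
∣p∪q∣≤∣p∣+∣q∣ (Subset.inside ∷ p) (Subset.inside ∷ q) =
  s≤s (ℕₚ.≤-trans (∣p∪q∣≤∣p∣+∣q∣ p q) (ℕₚ.+-monoʳ-≤ ∣ p ∣ (ℕₚ.n≤1+n ∣ q ∣)))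

module _ {v : ℕ} where

  fromList : List (Fin v) → Subset v
  fromList = ⋃ ∘ map ⁅_⁆

  ∈-fromList⁺ : ∀ {x xs} → x ∈ xs → x Subset.∈ fromList xs
  ∈-fromList⁺ (here ≡.refl) = Subsetₚ.x∈p∪q⁺ (inj₁ (Subsetₚ.x∈⁅x⁆ _))
  ∈-fromList⁺ (there x∈)    = Subsetₚ.x∈p∪q⁺ (inj₂ (∈-fromList⁺ x∈))

  ∈-fromList⁻ : ∀ {x} xs → x Subset.∈ fromList xs → x ∈ xs
  ∈-fromList⁻ []       x∈ = ⊥-elim (Subsetₚ.∉⊥ x∈)
  ∈-fromList⁻ (y ∷ xs) x∈ with Subsetₚ.x∈p∪q⁻ ⁅ y ⁆ (fromList xs) x∈
  ... | inj₁ x∈y  = here (Subsetₚ.x∈⁅y⁆⇒x≡y y x∈y)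
  ... | inj₂ x∈xs = there (∈-fromList⁻ xs x∈xs)

  ∣fromList∣≤length : ∀ xs → ∣ fromList xs ∣ ≤ length xs
  ∣fromList∣≤length []       = ℕₚ.≤-reflexive (Subsetₚ.∣⊥∣≡0 v)
  ∣fromList∣≤length (x ∷ xs) = ℕₚ.≤-trans (∣p∪q∣≤∣p∣+∣q∣ ⁅ x ⁆ (fromList xs))
    (ℕₚ.+-mono-≤ (ℕₚ.≤-reflexive (Subsetₚ.∣⁅x⁆∣≡1 x)) (∣fromList∣≤length xs))

  ∣p∣<n⇒∃∉ : (p : Subset v) → ∣ p ∣ < v → ∃ λ x → x Subset.∉ p
  ∣p∣<n⇒∃∉ p p<v with Finₚ.any? (λ x → ¬? (x Subsetₚ.∈? p))
  ... | yes found = found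
  ... | no ¬found = ⊥-elim (ℕₚ.<⇒≱ p<v (ℕₚ.≤-trans (ℕₚ.≤-reflexive (≡.sym (Subsetₚ.∣⊤∣≡n v)))
          (Subsetₚ.p⊆q⇒∣p∣≤∣q∣ {p = ⊤} λ {x} _ →
            decidable-stable (x Subsetₚ.∈? p) λ x∉ → ¬found (x , x∉))))

module _ {V : Set} (G : Graph V)
         (search : {P : V → Set} → (∀ u → Dec (P u)) → Dec (∃ P)) where

  open Graph G

  -- Start from any labelling with connected classes; discard unused labels and
  -- merge labels joined by an edge until neither is possible.
  componentCount-from : ∀ k (label : V → Fin k) →
    (∀ {u w} → label u ≡ label w → Star _~_ u w) → ∃ (ComponentCount G)
  componentCount-from zero label _ =
    0 , label , (λ ()) , λ u _ → case label u of λ ()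
  componentCount-from (suc k) label conn
    with Finₚ.any? (λ c → ¬? (search λ u → label u Finₚ.≟ c))
  ... | yes (c , unused) = componentCount-from k
          (λ u → punchOut (avoids u)) (λ {u} {w} → conn ∘ Finₚ.punchOut-injective (avoids u) (avoids w))
    where
    avoids : ∀ u → c ≢ label u
    avoids u c≡ = unused (u , ≡.sym c≡)
  ... | no used
    with search (λ u → search λ w → ~-dec u w ×-dec ¬? (label u Finₚ.≟ label w))
  ... | no ¬crossing = suc k , label ,
          (λ c → decidable-stable (search λ u → label u Finₚ.≟ c) (λ unused → used (c , unused))) ,
          λ u w → mk⇔ conn path⇒≡
    where
    path⇒≡ : ∀ {u w} → Star _~_ u w → label u ≡ label w
    path⇒≡ Star.ε = ≡.refl
    path⇒≡ {u} (_◅_ {j = w} u~w path) = ≡.trans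
      (decidable-stable (label u Finₚ.≟ label w) (λ differ → ¬crossing (u , w , u~w , differ))) (path⇒≡ path)
  ... | yes (u₀ , w₀ , u₀~w₀ , differ) = componentCount-from k (λ u → punchOut (avoids u))
          λ {u} {w} eq → let
              u′ , u≡ , u⇝u′ = anchor u
              w′ , w≡ , w⇝w′ = anchor w
            in u⇝u′ ◅◅ conn (≡.trans (≡.sym u≡)
                 (≡.trans (Finₚ.punchOut-injective (avoids u) (avoids w) eq) w≡)) ◅◅ Star.reverse ~-sym w⇝w′
    where
    -- The class of `u₀` takes over the label of `w₀`, which frees `label u₀` for removal by
    -- `punchOut`.
    merged : ∀ u → Dec (label u₀ ≡ label u) → Fin (suc k)
    merged u (yes _) = label w₀
    merged u (no _)  = label u
    at : ∀ u → Dec (label u₀ ≡ label u)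
    at u = label u₀ Finₚ.≟ label u
    avoids : ∀ u → label u₀ ≢ merged u (at u)
    avoids u with at u
    ... | yes _ = differ
    ... | no ≢u = ≢u
    -- Reaches from `u` a vertex whose old label is the new label of `u`, so that equality of new
    -- labels reduces to `conn` for old ones.
    anchor : ∀ u → ∃ λ u′ → merged u (at u) ≡ label u′ × Star _~_ u u′
    anchor u with at u
    ... | yes ≡u = w₀ , ≡.refl , conn (≡.sym ≡u) ◅◅ u₀~w₀ ◅ Star.ε
    ... | no _   = u , ≡.refl , Star.ε

module _ {v : ℕ} where

  Outside : Subset v → Set
  Outside S = Σ[ u ∈ Fin v ] u Subset.∈ ∁ S

  outside : ∀ {S u} → u Subset.∉ S → Outside S
  outside u∉S = -, Subsetₚ.x∉p⇒x∈∁p u∉S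

  Outside-≡ : ∀ {S} {x y : Outside S} → proj₁ x ≡ proj₁ y → x ≡ y
  Outside-≡ eq = Σ-≡,≡→≡ (eq , []=-irrelevant _ _)

  Outside-search : ∀ {S} {P : Outside S → Set} → (∀ u → Dec (P u)) → Dec (∃ P)
  Outside-search {S} {P} P? with Finₚ.any? (λ u → member u (u Subsetₚ.∈? ∁ S))
    where
    member : ∀ u → Dec (u Subset.∈ ∁ S) → Dec (Σ[ p ∈ u Subset.∈ ∁ S ] P (u , p))
    member u (no ∉)  = no (∉ ∘ proj₁)
    member u (yes p) with P? (u , p)
    ... | yes Pu = yes (p , Pu)
    ... | no ¬Pu = no λ (q , Pu) → ¬Pu (subst (λ r → P (u , r)) ([]=-irrelevant q p) Pu)
  ... | yes (u , p , Pu) = yes ((u , p) , Pu)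
  ... | no ¬P            = no λ ((u , p) , Pu) → ¬P (u , p , Pu)

  componentCount : ∀ (G : Graph (Fin v)) S → ∃ (ComponentCount (G − S))
  -- Initially every vertex is its own label, so each class is a single vertex.
  componentCount G S = componentCount-from (G − S) Outside-search v proj₁
    (λ eq → subst (Star _ _) (Outside-≡ eq) Star.ε)

label≢⇒2≤ : ∀ {k} {i j : Fin k} → i ≢ j → 2 ≤ k
label≢⇒2≤ {suc zero} {zero} {zero} i≢j = ⊥-elim (i≢j ≡.refl)
label≢⇒2≤ {suc (suc k)} _ = s≤s (s≤s z≤n)

≈ₑ-cancelˡ : ∀ {A : Set} {a b c : A} → (a , b) ≈ₑ (a , c) → b ≡ c
≈ₑ-cancelˡ (inj₁ ≡.refl) = ≡.refl
≈ₑ-cancelˡ (inj₂ ≡.refl) = ≡.refl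

≈ₑ⇒∈ₑ : ∀ {A : Set} {x y : A} {e} → (x , y) ≈ₑ e → x ∈ₑ e
≈ₑ⇒∈ₑ (inj₁ ≡.refl) = inj₁ ≡.refl
≈ₑ⇒∈ₑ (inj₂ ≡.refl) = inj₂ ≡.refl

partner-unique : ∀ {A : Set} {N : List (Edge A)} → AllPairs Independent N →
  ∀ {a b c} → (a , b) ∈ₘ N → (a , c) ∈ₘ N → b ≡ c
partner-unique ind ab∈ ac∈
  with e , e∈ , ab≈e ← find ab∈ | f , f∈ , ac≈f ← find ac∈
  with ∈-AllPairs₂ ind e∈ f∈
... | inj₁ ≡.refl      = ≈ₑ-cancelˡ (≈ₑ-trans ab≈e (≈ₑ-sym ac≈f))
... | inj₂ (inj₁ e#f)  = ⊥-elim (e#f (≈ₑ⇒∈ₑ ab≈e) (≈ₑ⇒∈ₑ ac≈f))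
... | inj₂ (inj₂ f#e)  = ⊥-elim (f#e (≈ₑ⇒∈ₑ ac≈f) (≈ₑ⇒∈ₑ ab≈e))

∈ₑ⇒∈-vertices : ∀ {A : Set} {u : A} {M} → Any (u ∈ₑ_) M → u ∈ vertices M
∈ₑ⇒∈-vertices (here (inj₁ ≡.refl)) = here ≡.refl
∈ₑ⇒∈-vertices (here (inj₂ ≡.refl)) = there (here ≡.refl)
∈ₑ⇒∈-vertices (there u∈)           = there (there (∈ₑ⇒∈-vertices u∈))

∈-vertices⇒∈ₑ : ∀ {A : Set} {u : A} {M} → u ∈ vertices M → Any (u ∈ₑ_) M
∈-vertices⇒∈ₑ u∈ = Any.map (λ (_ , uy≈e) → ≈ₑ⇒∈ₑ uy≈e) (∈-vertices⇒Any u∈)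

independent⇒unique : ∀ {V : Set} (G : Graph V) {M} → IsMatching G M → Unique (vertices M)
independent⇒unique G {[]} _ = []
independent⇒unique G {(x , y) ∷ M} (x~y ∷ adj , e# ∷ ind) =
  ((λ x≡y → Graph.~-irrefl G x≡y x~y) ∷ All.tabulate (fresh (inj₁ ≡.refl))) ∷
  All.tabulate (fresh (inj₂ ≡.refl)) ∷ independent⇒unique G (adj , ind)
  where
  fresh : ∀ {u w} → u ∈ₑ (x , y) → w ∈ vertices M → u ≢ w
  fresh u∈e w∈ ≡.refl with f , f∈ , u∈f ← find (∈-vertices⇒∈ₑ w∈) = All.lookup e# f∈ u∈e u∈f

unique⇒independent : ∀ {V : Set} {M : List (Edge V)} → Unique (vertices M) → AllPairs Independent M
unique⇒independent {M = []} _ = []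
unique⇒independent {M = (x , y) ∷ M} ((_ ∷ x∉) ∷ y∉ ∷ M!) =
  All.tabulate (λ f∈ → λ where
    (inj₁ ≡.refl) u∈f → All.lookup x∉ (∈ₑ⇒∈-vertices (lose f∈ u∈f)) ≡.refl
    (inj₂ ≡.refl) u∈f → All.lookup y∉ (∈ₑ⇒∈-vertices (lose f∈ u∈f)) ≡.refl) ∷
  unique⇒independent M!

-- Counting inequalities for the cut

module _ where
  open ℕ-Solver.+-*-Solver using (solve; con; _:+_; _:*_; _:=_)
  open ℕₚ.≤-Reasoning

  -- Here `m′` and `n′` are the sizes of `M` and `N`, and `q` and `c` the component counts before
  -- and after deleting ends of `N`. The size `n′` enters twice, as vertices added to the cut and as
  -- components lost.
  cut-arithmetic : ∀ {m n m′ n′ s q c T T′} → m′ ≤ m → n′ ≤ n → T ≤ s + m′ * 2 →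
    T′ ≤ T + n′ → 2 + s ≤ q → q ≤ c + n′ → T′ + 2 ≤ c + 2 * (m + n)
  cut-arithmetic {m} {n} {m′} {n′} {s} {q} {c} {T} {T′} m′≤ n′≤ T≤ T′≤ s≤ q≤ = begin
    T′ + 2                    ≤⟨ ℕₚ.+-monoˡ-≤ 2 (ℕₚ.≤-trans T′≤ (ℕₚ.+-monoˡ-≤ n′ T≤)) ⟩
    s + m′ * 2 + n′ + 2
      ≡⟨ solve 3 (λ s m n → s :+ m :* con 2 :+ n :+ con 2
           := (con 2 :+ s) :+ (m :* con 2 :+ n)) ≡.refl s m′ n′ ⟩
    2 + s + (m′ * 2 + n′)     ≤⟨ ℕₚ.+-monoˡ-≤ (m′ * 2 + n′) (ℕₚ.≤-trans s≤ q≤) ⟩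
    c + n′ + (m′ * 2 + n′)
      ≡⟨ solve 3 (λ c m n → c :+ n :+ (m :* con 2 :+ n) := c :+ con 2 :* (m :+ n)) ≡.refl c m′ n′ ⟩
    c + 2 * (m′ + n′)         ≤⟨ ℕₚ.+-monoʳ-≤ c (ℕₚ.*-monoʳ-≤ 2 (ℕₚ.+-mono-≤ m′≤ n′≤)) ⟩
    c + 2 * (m + n)           ∎

  -- If `S` is empty, `T` has at most 2m vertices and the bound on the order leaves three others. If
  -- not, `U` alone supplies at least three.
  room-arithmetic : ∀ {m n m′ u z T v} s → m′ ≤ m → T ≤ s + m′ * 2 → 2 + s ≤ u →
    v ≡ m′ * 2 + (s + (u + z)) → 2 * m + 2 * n + 2 < v → T + 3 ≤ v
  room-arithmetic {m} {n} {m′} {T = T} {v} zero m′≤ T≤ _ _ order = begin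
    T + 3              ≤⟨ ℕₚ.+-monoˡ-≤ 3 T≤ ⟩
    m′ * 2 + 3         ≤⟨ ℕₚ.+-monoˡ-≤ 3 (ℕₚ.*-monoˡ-≤ 2 m′≤) ⟩
    m * 2 + 3          ≤⟨ ℕₚ.m≤m+n (m * 2 + 3) (2 * n) ⟩
    m * 2 + 3 + 2 * n
      ≡⟨ solve 2 (λ m n → m :* con 2 :+ con 3 :+ con 2 :* n
           := con 1 :+ (con 2 :* m :+ con 2 :* n :+ con 2)) ≡.refl m n ⟩
    suc (2 * m + 2 * n + 2) ≤⟨ order ⟩
    v                  ∎
  room-arithmetic {m′ = m′} {u} {z} {T} {v} (suc s) _ T≤ s≤ v≡ _ = begin
    T + 3                                 ≤⟨ ℕₚ.+-monoˡ-≤ 3 T≤ ⟩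
    suc s + m′ * 2 + 3                    ≤⟨ ℕₚ.m≤m+n _ s ⟩
    suc s + m′ * 2 + 3 + s
      ≡⟨ solve 2 (λ s m → con 1 :+ s :+ m :* con 2 :+ con 3 :+ s
           := m :* con 2 :+ (con 1 :+ s :+ (con 3 :+ s))) ≡.refl s m′ ⟩
    m′ * 2 + (suc s + (3 + s))
      ≤⟨ ℕₚ.+-monoʳ-≤ (m′ * 2) (ℕₚ.+-monoʳ-≤ (suc s) (ℕₚ.≤-trans s≤ (ℕₚ.m≤m+n u z))) ⟩
    m′ * 2 + (suc s + (u + z))            ≡⟨ v≡ ⟨
    v                                     ∎

-- Cut sets of `G` from components of `G ∖ N`

module _ {v : ℕ} (G : Graph (Fin v)) where
  open Graph G

  module _ {N : List (Edge (Fin v))} (N-matching : IsMatching G N) (T : Subset v) (T+3≤v : ∣ T ∣ + 3 ≤ v)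
           {q : ℕ} (components : ComponentCount ((G ∖ N) − T) q) (2≤q : 2 ≤ q) where

    private
      label = proj₁ components
      rep   = proj₁ ∘ proj₁ (proj₂ components)

      label-rep : ∀ i → label (rep i) ≡ i
      label-rep i = proj₂ (proj₁ (proj₂ components) i)

      path⇒label≡ : ∀ {x y} → Star (Graph._~_ ((G ∖ N) − T)) x y → label x ≡ label y
      path⇒label≡ = Equivalence.from (proj₂ (proj₂ components) _ _)

      _∈N? : (e : Edge (Fin v)) → Dec (e ∈ₘ N)
      e ∈N? = any? (_≈ₑ?_ Finₚ._≟_ e) N

    third : ∀ (a b : Outside T) → ∃ λ (x : Outside T) → proj₁ x ≢ proj₁ a × proj₁ x ≢ proj₁ b
    third (a , _) (b , _) = outside (x∉ ∘ Subsetₚ.x∈p∪q⁺ ∘ inj₁) ,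
      (λ x≡a → x∉ (Subsetₚ.x∈p∪q⁺ (inj₂ (∈-fromList⁺ {xs = a ∷ b ∷ []} (here x≡a))))) ,
      (λ x≡b → x∉ (Subsetₚ.x∈p∪q⁺ (inj₂ (∈-fromList⁺ {xs = a ∷ b ∷ []} (there (here x≡b))))))
      where
      ab = fromList (a ∷ b ∷ [])
      small : ∣ T ∪ ab ∣ < v
      small = begin-strict
        ∣ T ∪ ab ∣       ≤⟨ ∣p∪q∣≤∣p∣+∣q∣ T ab ⟩
        ∣ T ∣ + ∣ ab ∣   ≤⟨ ℕₚ.+-monoʳ-≤ ∣ T ∣ (∣fromList∣≤length (a ∷ b ∷ [])) ⟩
        ∣ T ∣ + 2        <⟨ ℕₚ.+-monoʳ-< ∣ T ∣ (ℕₚ.n<1+n 2) ⟩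
        ∣ T ∣ + 3        ≤⟨ T+3≤v ⟩
        v                ∎
        where open ℕₚ.≤-Reasoning
      x∉ = proj₂ (∣p∣<n⇒∃∉ (T ∪ ab) small)

    -- If `N` joins `a` to `b`, a third vertex `x` lies in a component different from that of `a` or
    -- of `b`. Paired with that vertex it works, because the `N`-partner of `a` or `b` is already
    -- taken.
    separated-pair : ∃₂ λ (a b : Outside T) → label a ≢ label b × ¬ (proj₁ a , proj₁ b) ∈ₘ N
    -- The representatives of the labels 1 and 0; `2≤q` is read as 1 < `q`.
    separated-pair = improve (rep (Fin.fromℕ< 2≤q)) (rep (Fin.fromℕ< (ℕₚ.<⇒≤ 2≤q))) λ eq →
      case Finₚ.fromℕ<-injective 1 0 2≤q (ℕₚ.<⇒≤ 2≤q)
             (≡.trans (≡.sym (label-rep _)) (≡.trans eq (label-rep _))) of λ ()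
      where
      improve : ∀ a b → label a ≢ label b →
        ∃₂ λ (a b : Outside T) → label a ≢ label b × ¬ (proj₁ a , proj₁ b) ∈ₘ N
      improve a b a≢b with (proj₁ a , proj₁ b) ∈N?
      ... | no ab∉N = a , b , a≢b , ab∉N
      ... | yes ab∈N with x , x≢a , x≢b ← third a b with label x Finₚ.≟ label b
      ...   | no lx≢lb  = x , b , lx≢lb ,
        λ xb∈N → x≢a (partner-unique (proj₂ N-matching) (∈ₘ-swap xb∈N) (∈ₘ-swap ab∈N))
      ...   | yes lx≡lb = a , x , (λ la≡lx → a≢b (≡.trans la≡lx lx≡lb)) ,
        λ ax∈N → x≢b (partner-unique (proj₂ N-matching) ax∈N ab∈N)

    -- Deleting one end of every edge of N turns components of (G ∖ N) − T into
    -- unions of components; sparing both ends of a separated pair keeps the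
    -- graph disconnected.
    cut-at-ends : ∃₂ λ T′ c → ComponentCount (G − T′) c × 2 ≤ c ×
                  ∣ T′ ∣ ≤ ∣ T ∣ + length N × q ≤ c + length N
    cut-at-ends = T′ , c , count , label≢⇒2≤ a′≢b′ , T′-small , q-small
      where
      a = proj₁ separated-pair
      b = proj₁ (proj₂ separated-pair)
      a≢b = proj₁ (proj₂ (proj₂ separated-pair))
      ab∉N = proj₂ (proj₂ (proj₂ separated-pair))

      spared? : ∀ u → Dec (u ≡ proj₁ a ⊎ u ≡ proj₁ b)
      spared? u = (u Finₚ.≟ proj₁ a) ⊎-dec (u Finₚ.≟ proj₁ b)

      end-of : ∀ {y} → Fin v → Dec (y ≡ proj₁ a ⊎ y ≡ proj₁ b) → Fin v
      end-of {y} z (yes _) = z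
      end-of {y} z (no _)  = y

      end : Edge (Fin v) → Fin v
      end (y , z) = end-of z (spared? y)

      -- The second end is chosen only if the first is `a` or `b`. It could then be spared too only
      -- if the edge were a loop or joined `a` to `b`.
      end-spares : ∀ {e} → e ∈ N → ¬ (end e ≡ proj₁ a ⊎ end e ≡ proj₁ b)
      end-spares {y , z} e∈N with spared? y
      ... | no ¬spared = ¬spared
      ... | yes (inj₁ ≡.refl) = λ where
        (inj₁ z≡a)    → ~-irrefl (≡.sym z≡a) (All.lookup (proj₁ N-matching) e∈N)
        (inj₂ ≡.refl) → ab∉N (lose e∈N (inj₁ ≡.refl))
      ... | yes (inj₂ ≡.refl) = λ where
        (inj₁ ≡.refl) → ab∉N (lose e∈N (inj₂ ≡.refl))
        (inj₂ z≡b)    → ~-irrefl (≡.sym z≡b) (All.lookup (proj₁ N-matching) e∈N)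

      end∈ₑ : ∀ e → end e ∈ₑ e
      end∈ₑ (y , z) with spared? y
      ... | yes _ = inj₂ ≡.refl
      ... | no _  = inj₁ ≡.refl

      X  = map end N
      T′ = T ∪ fromList X

      spares : ∀ {u} → u ≡ proj₁ a ⊎ u ≡ proj₁ b → u ∉ X
      spares u≡ u∈ with e , e∈N , ≡.refl ← ∈-map⁻ end u∈ = end-spares e∈N u≡

      T′-small : ∣ T′ ∣ ≤ ∣ T ∣ + length N
      T′-small = ℕₚ.≤-trans (∣p∪q∣≤∣p∣+∣q∣ T (fromList X)) (ℕₚ.+-monoʳ-≤ ∣ T ∣
        (ℕₚ.≤-trans (∣fromList∣≤length X) (ℕₚ.≤-reflexive (length-map end N))))

      -- Every edge of `N` has an end in `T′`, so paths of `G − T′` are paths of `(G ∖ N) − T`.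
      avoid-N : ∀ {u w} → u Subset.∉ T′ → w Subset.∉ T′ → ¬ (u , w) ∈ₘ N
      avoid-N u∉ w∉ uw∈N with e , e∈N , uw≈e ← find uw∈N = case uw≈e of λ where
          (inj₁ ≡.refl) → [ (λ end≡ → u∉ (subst (Subset._∈ T′) end≡ end∈T′)) ,
                            (λ end≡ → w∉ (subst (Subset._∈ T′) end≡ end∈T′)) ]′ (end∈ₑ e)
          (inj₂ ≡.refl) → [ (λ end≡ → w∉ (subst (Subset._∈ T′) end≡ end∈T′)) ,
                            (λ end≡ → u∉ (subst (Subset._∈ T′) end≡ end∈T′)) ]′ (end∈ₑ e)
        where
        end∈T′ : end e Subset.∈ T′
        end∈T′ = Subsetₚ.x∈p∪q⁺ (inj₂ (∈-fromList⁺ (∈-map⁺ end e∈N)))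

      lift : Outside T′ → Outside T
      lift (u , u∈) = outside (Subsetₚ.x∈∁p⇒x∉p u∈ ∘ Subsetₚ.x∈p∪q⁺ ∘ inj₁)

      lower : ∀ (x : Outside T) → proj₁ x ∉ X → ∃ λ x′ → lift x′ ≡ x
      lower (u , u∈) u∉X = outside
        ([ Subsetₚ.x∈∁p⇒x∉p u∈ , u∉X ∘ ∈-fromList⁻ X ]′ ∘ Subsetₚ.x∈p∪q⁻ T (fromList X)) , Outside-≡ ≡.refl

      c      = proj₁ (componentCount G T′)
      count  = proj₂ (componentCount G T′)
      label′ = proj₁ count

      refines : ∀ {x y} → label′ x ≡ label′ y → label (lift x) ≡ label (lift y)
      refines = path⇒label≡ ∘ Star.gmap lift
        (λ {(_ , u∈) (_ , w∈)} u~w → u~w , avoid-N (Subsetₚ.x∈∁p⇒x∉p u∈) (Subsetₚ.x∈∁p⇒x∉p w∈))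
        ∘ Equivalence.to (proj₂ (proj₂ count) _ _)

      a′ = lower a (spares (inj₁ ≡.refl))
      b′ = lower b (spares (inj₂ ≡.refl))

      a′≢b′ : label′ (proj₁ a′) ≢ label′ (proj₁ b′)
      a′≢b′ eq = a≢b (≡.subst₂ (λ x y → label x ≡ label y) (proj₂ a′) (proj₂ b′) (refines eq))

      -- The representative of an old component either survives, and then names a component of
      -- `G − T′`, or was deleted, and then occupies a position in `X`. Both outcomes determine the
      -- old component, which gives `q-small`.
      fate : ∀ i → (∃ λ x′ → lift x′ ≡ rep i) ⊎ (∃ λ j → lookup X j ≡ proj₁ (rep i))
      fate i with any? (proj₁ (rep i) Finₚ.≟_) X
      ... | yes i∈X = inj₂ (Any.index i∈X , ≡.sym (Anyₚ.lookup-index i∈X))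
      ... | no i∉X  = inj₁ (lower (rep i) i∉X)

      fate-code : ∀ {i} → (∃ λ x′ → lift x′ ≡ rep i) ⊎ (∃ λ j → lookup X j ≡ proj₁ (rep i)) →
        Fin c ⊎ Fin (length X)
      fate-code = Sum.map (label′ ∘ proj₁) proj₁

      rep-injective : ∀ {i j} → label (rep i) ≡ label (rep j) → i ≡ j
      rep-injective eq = ≡.trans (≡.sym (label-rep _)) (≡.trans eq (label-rep _))

      fate-code-injective : ∀ {i j} f g → fate-code {i} f ≡ fate-code {j} g → i ≡ j
      fate-code-injective (inj₁ (x , x≡)) (inj₁ (y , y≡)) eq =
        rep-injective (≡.subst₂ (λ r s → label r ≡ label s) x≡ y≡ (refines {x} {y} (inj₁-injective eq)))
      fate-code-injective (inj₂ (k , k≡)) (inj₂ (l , l≡)) eq = rep-injective (cong label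
        (Outside-≡ (≡.trans (≡.sym k≡) (≡.trans (cong (lookup X) (inj₂-injective eq)) l≡))))

      q-small : q ≤ c + length N
      q-small = subst (λ l → q ≤ c + l) (length-map end N)
        (Finₚ.injective⇒≤ {f = Fin.join c (length X) ∘ fate-code ∘ fate} λ {i} {j} eq →
          fate-code-injective (fate i) (fate j)
            (≡.trans (≡.sym (Finₚ.splitAt-join c _ (fate-code (fate i))))
              (≡.trans (cong (Fin.splitAt c) eq) (Finₚ.splitAt-join c _ (fate-code (fate j))))))

  -- Entries without a connecting path cannot share a label, so labelling injects the positions of
  -- `U`. Quantifying over `u∉` and `w∉` lets `apart` meet whichever proofs `class` carries.
  apart⇒≤components : ∀ {T q} → ComponentCount (G − T) q → ∀ U →
    (outside-T : ∀ {u} → u ∈ U → u Subset.∉ T) →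
    AllPairs (λ u w → ∀ (u∉ : u Subset.∉ T) (w∉ : w Subset.∉ T) →
                      ¬ Star (Graph._~_ (G − T)) (outside u∉) (outside w∉)) U →
    length U ≤ q
  apart⇒≤components {T} {q} (label , _ , label⇔path) U outside-T apart = Finₚ.injective⇒≤ injective
    where
    class : Fin (length U) → Fin q
    class i = label (outside (outside-T (∈-lookup {xs = U} i)))
    injective : ∀ {i j} → class i ≡ class j → i ≡ j
    injective {i} {j} eq with Finₚ.<-cmp i j
    ... | tri< i<j _ _ = ⊥-elim (AllPairs-lookup apart i<j _ _ (Equivalence.to (label⇔path _ _) eq))
    ... | tri≈ _ i≡j _ = i≡j
    ... | tri> _ _ j<i = ⊥-elim (AllPairs-lookup apart j<i _ _ (Equivalence.to (label⇔path _ _) (≡.sym eq)))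

-- Extendability from an integral form of toughness

module _ {v : ℕ} (G : Graph (Fin v)) (2∣v : 2 ∣ v) (¬complete : ¬ Complete G) (m n : ℕ)
         (tough : ∀ T c → ComponentCount (G − T) c → 2 ≤ c → c + 2 * (m + n) < ∣ T ∣ + 2) where
  open Graph G

  non-adjacent : ∃₂ λ u w → u ≢ w × ¬ u ~ w
  non-adjacent with Finₚ.any? (λ u → Finₚ.any? λ w → ¬? (u Finₚ.≟ w) ×-dec ¬? (~-dec u w))
  ... | yes found = found
  ... | no ¬found = ⊥-elim (¬complete λ {u} {w} u≢w →
          decidable-stable (~-dec u w) λ ¬u~w → ¬found (u , w , u≢w , ¬u~w))

  -- Deleting all vertices but two non-adjacent ones leaves two components; `tough` is applied to
  -- that cut.
  order-bound : 2 * m + 2 * n + 2 < v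
  order-bound with u , w , u≢w , ¬u~w ← non-adjacent = begin-strict
    2 * m + 2 * n + 2    ≡⟨ ≡.trans (ℕₚ.+-comm _ 2) (cong (2 +_) (≡.sym (ℕₚ.*-distribˡ-+ 2 m n))) ⟩
    2 + 2 * (m + n)      ≤⟨ ℕₚ.+-monoˡ-≤ (2 * (m + n)) (label≢⇒2≤ distinct) ⟩
    c + 2 * (m + n)      <⟨ tough (∁ p) c count (label≢⇒2≤ distinct) ⟩
    ∣ ∁ p ∣ + 2          ≤⟨ ℕₚ.+-monoʳ-≤ ∣ ∁ p ∣ 2≤p ⟩
    ∣ ∁ p ∣ + ∣ p ∣      ≡⟨ cong (_+ ∣ p ∣) (Subsetₚ.∣∁p∣≡n∸∣p∣ p) ⟩
    v ∸ ∣ p ∣ + ∣ p ∣    ≡⟨ ℕₚ.m∸n+n≡m (Subsetₚ.∣p∣≤n p) ⟩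
    v                    ∎
    where
    open ℕₚ.≤-Reasoning
    p = ⁅ u ⁆ ∪ ⁅ w ⁆
    2≤p : 2 ≤ ∣ p ∣
    2≤p = subst (_< ∣ p ∣) (Subsetₚ.∣⁅x⁆∣≡1 u) (Subsetₚ.p⊂q⇒∣p∣<∣q∣
      (Subsetₚ.p⊆p∪q ⁅ w ⁆ , w , Subsetₚ.x∈p∪q⁺ (inj₂ (Subsetₚ.x∈⁅x⁆ w)) , Subsetₚ.x≢y⇒x∉⁅y⁆ (u≢w ∘ ≡.sym)))
    c     = proj₁ (componentCount G (∁ p))
    count = proj₂ (componentCount G (∁ p))
    kept : ∀ {x} → x Subset.∈ p → Outside (∁ p)
    kept x∈ = outside (Subsetₚ.x∈p⇒x∉∁p x∈)
    u′ = kept (Subsetₚ.x∈p∪q⁺ (inj₁ (Subsetₚ.x∈⁅x⁆ u)))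
    w′ = kept (Subsetₚ.x∈p∪q⁺ (inj₂ (Subsetₚ.x∈⁅x⁆ w)))
    isolated : ∀ (y : Outside (∁ p)) → ¬ u ~ proj₁ y
    isolated (y , y∈) u~y with Subsetₚ.x∈p∪q⁻ ⁅ u ⁆ ⁅ w ⁆
      (decidable-stable (y Subsetₚ.∈? p) (Subsetₚ.x∈∁p⇒x∉p y∈ ∘ Subsetₚ.x∉p⇒x∈∁p))
    ... | inj₁ y∈u = ~-irrefl (≡.sym (Subsetₚ.x∈⁅y⁆⇒x≡y u y∈u)) u~y
    ... | inj₂ y∈w = ¬u~w (subst (u ~_) (Subsetₚ.x∈⁅y⁆⇒x≡y w y∈w) u~y)
    no-path : ∀ {x y : Outside (∁ p)} → proj₁ x ≡ u → proj₁ y ≡ w → ¬ Star (Graph._~_ (G − ∁ p)) x y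
    no-path x≡u y≡w Star.ε = u≢w (≡.trans (≡.sym x≡u) y≡w)
    no-path x≡u y≡w (_◅_ {j = z} x~z _) = isolated z (subst (_~ proj₁ z) x≡u x~z)
    distinct : proj₁ count u′ ≢ proj₁ count w′
    distinct eq = no-path ≡.refl ≡.refl (Equivalence.to (proj₂ (proj₂ count) _ _) eq)

  module _ {N : List (Edge (Fin v))} (N-matching : IsMatching G N) (N≤n : length N ≤ n) where

    private
      room : ∣ ⊥ {v} ∣ + 3 ≤ v
      room = ℕₚ.≤-trans (ℕₚ.≤-reflexive (cong (_+ 3) (Subsetₚ.∣⊥∣≡0 v)))
        (ℕₚ.≤-trans (s≤s (ℕₚ.m≤n+m 2 (2 * m + 2 * n))) order-bound)

    -- Otherwise `cut-at-ends` with nothing deleted beforehand gives a cut set of at most `n`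
    -- vertices, too small for `tough`.
    ∖-connected : Connected (G ∖ N)
    ∖-connected u w = connect (proj₂ (componentCount (G ∖ N) ⊥))
      where
      open ℕₚ.≤-Reasoning

      no-cut : ∀ {q} → ¬ (∃₂ λ T c → ComponentCount (G − T) c × 2 ≤ c ×
        ∣ T ∣ ≤ ∣ ⊥ {v} ∣ + length N × q ≤ c + length N)
      no-cut (T , c , count , 2≤c , T≤ , _) = ℕₚ.<⇒≱ (tough T c count 2≤c) (begin
        ∣ T ∣ + 2                 ≤⟨ ℕₚ.+-monoˡ-≤ 2 T≤ ⟩
        ∣ ⊥ {v} ∣ + length N + 2  ≡⟨ cong (λ k → k + length N + 2) (Subsetₚ.∣⊥∣≡0 v) ⟩
        length N + 2
          ≤⟨ ℕₚ.+-mono-≤ (ℕₚ.≤-trans N≤n (ℕₚ.≤-trans (ℕₚ.m≤n+m n m) (ℕₚ.m≤m+n (m + n) _))) 2≤c ⟩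
        2 * (m + n) + c           ≡⟨ ℕₚ.+-comm (2 * (m + n)) c ⟩
        c + 2 * (m + n)           ∎)

      u′ = outside (Subsetₚ.∉⊥ {x = u})
      w′ = outside (Subsetₚ.∉⊥ {x = w})

      connect : ∀ {q} → ComponentCount ((G ∖ N) − ⊥) q → Star (Graph._~_ (G ∖ N)) u w
      connect components@(label , _ , label⇔path) with label u′ Finₚ.≟ label w′
      ... | yes eq = Star.gmap proj₁ id (Equivalence.to (label⇔path u′ w′) eq)
      ... | no differ = ⊥-elim (no-cut (cut-at-ends G N-matching ⊥ room components (label≢⇒2≤ differ)))

    module _ {M : List (Edge (Fin v))} (M-matching : IsMatching (G ∖ N) M) (M≤m : length M ≤ m) where

      private
        complement : ∃ λ V → allFin v ↭ vertices M ++ V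
        complement = Unique-⊆⇒↭ (independent⇒unique (G ∖ N) M-matching) (λ _ → ∈-allFin _)
        V = proj₁ complement

        MV! : Unique (vertices M ++ V)
        MV! = Unique-resp-↭ (proj₂ complement) (allFin⁺ v)

        v≡ : v ≡ length M * 2 + length V
        v≡ = ≡.trans (≡.sym (length-tabulate {n = v} id)) (≡.trans (↭-length (proj₂ complement))
          (≡.trans (length-++ (vertices M)) (cong (_+ length V) (length-vertices M))))

      -- `V` lists the vertices that `M` leaves uncovered. Once `V(M)` is deleted together with `S`,
      -- exactly `U ++ Z` remains, so the paths forbidden by the barrier are those of `(G ∖ N) − T`.
      barrier⇒components : (barrier : Barrier (Graph._~_ (G ∖ N)) V) → let s = length (Barrier.S barrier) in
        ∃₂ λ T q → ComponentCount ((G ∖ N) − T) q × ∣ T ∣ ≤ s + length M * 2 × ∣ T ∣ + 3 ≤ v × 2 + s ≤ q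
      barrier⇒components barrier = T , q , components , T≤ , T-room , ℕₚ.≤-trans large U≤q
        where
        open Barrier barrier
        T = fromList (S ++ vertices M)
        rest : allFin v ↭ (S ++ vertices M) ++ (U ++ Z)
        rest = begin
          allFin v                         ↭⟨ proj₂ complement ⟩
          vertices M ++ V                  ↭⟨ ++⁺ˡ (vertices M) split ⟨
          vertices M ++ S ++ U ++ Z        ↭⟨ shifts (vertices M) S ⟩
          S ++ vertices M ++ U ++ Z        ≡⟨ ++-assoc S (vertices M) (U ++ Z) ⟨
          (S ++ vertices M) ++ (U ++ Z)    ∎
          where open PermutationReasoning
        T≤ : ∣ T ∣ ≤ length S + length M * 2
        T≤ = ℕₚ.≤-trans (∣fromList∣≤length (S ++ vertices M)) (ℕₚ.≤-reflexive
          (≡.trans (length-++ S) (cong (length S +_) (length-vertices M))))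
        ∉T⇒∈ : ∀ {x} → x Subset.∉ T → x ∈ U ++ Z
        ∉T⇒∈ {x} x∉ = [ ⊥-elim ∘ x∉ ∘ ∈-fromList⁺ , id ]′
          (∈-++⁻ (S ++ vertices M) (∈-resp-↭ rest (∈-allFin x)))
        ∈⇒∉T : ∀ {x} → x ∈ U → x Subset.∉ T
        ∈⇒∉T x∈U x∈T = Unique-++⇒≢ (Unique-resp-↭ rest (allFin⁺ v))
          (∈-fromList⁻ (S ++ vertices M) x∈T) (∈-++⁺ˡ x∈U) ≡.refl
        components = proj₂ (componentCount (G ∖ N) T)
        q          = proj₁ (componentCount (G ∖ N) T)
        U≤q : length U ≤ q
        U≤q = apart⇒≤components (G ∖ N) components U ∈⇒∉T (AllPairs.map
          (λ ¬path _ _ path → ¬path (Star.gmap proj₁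
            (λ {(_ , x∈) (_ , y∈)} x~y → ∉T⇒∈ (Subsetₚ.x∈∁p⇒x∉p x∈) , ∉T⇒∈ (Subsetₚ.x∈∁p⇒x∉p y∈) , x~y) path))
          apart)
        T-room : ∣ T ∣ + 3 ≤ v
        T-room = room-arithmetic {n = n} (length S) M≤m T≤ large (≡.trans v≡ (cong (length M * 2 +_)
          (≡.trans (↭-length (↭-sym split)) (≡.trans (length-++ S) (cong (length S +_) (length-++ U))))))
          order-bound


      no-barrier : ¬ Barrier (Graph._~_ (G ∖ N)) V
      no-barrier barrier = no-components (barrier⇒components barrier)
        where
        s = length (Barrier.S barrier)
        no-cut : ∀ {T q} → ∣ T ∣ ≤ s + length M * 2 → 2 + s ≤ q →
          ¬ (∃₂ λ T′ c → ComponentCount (G − T′) c × 2 ≤ c × ∣ T′ ∣ ≤ ∣ T ∣ + length N × q ≤ c + length N)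
        no-cut T≤ s≤q (T′ , c , count , 2≤c , T′≤ , q≤) =
          ℕₚ.<⇒≱ (tough T′ c count 2≤c) (cut-arithmetic M≤m N≤n T≤ T′≤ s≤q q≤)
        no-components : ¬ (∃₂ λ T q → ComponentCount ((G ∖ N) − T) q ×
          ∣ T ∣ ≤ s + length M * 2 × ∣ T ∣ + 3 ≤ v × 2 + s ≤ q)
        no-components (T , q , components , T≤ , T-room , s≤q) = no-cut {T} T≤ s≤q
          (cut-at-ends G N-matching T T-room components (ℕₚ.≤-trans (ℕₚ.m≤m+n 2 s) s≤q))

      -- The sizes of `M` and `N` are bounded rather than fixed, so empty matchings are allowed;
      -- these provide the perfect matchings that both notions of extendability ask for.
      extend-matching : ∃ λ F → IsPerfectMatching (G ∖ N) F × M ⊆ₘ F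
      extend-matching with tutte Finₚ._≟_ (Unique-++⇒ʳ (vertices M) MV!)
          -- `M` covers an even number of vertices, so `V` inherits even length from the order.
          (∣m+n∣m⇒∣n (subst (2 ∣_) v≡ 2∣v) (divides-refl (length M)))
          (Graph.~-dec (G ∖ N)) (Graph.~-sym (G ∖ N))
      ... | inj₂ barrier = ⊥-elim (no-barrier barrier)
      ... | inj₁ (F , F-edges , F↭V) = M ++ F ,
        ((Allₚ.++⁺ (proj₁ M-matching) F-edges ,
          unique⇒independent (Unique-resp-↭ (↭-sym MF↭) (allFin⁺ v))) ,
         (λ u → ∈-vertices⇒∈ₑ (∈-resp-↭ (↭-sym MF↭) (∈-allFin u)))) ,
        Anyₚ.++⁺ˡ
        where
        MF↭ : vertices (M ++ F) ↭ allFin v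
        MF↭ = trans (↭-reflexive (vertices-++ M F))
                (trans (++⁺ˡ (vertices M) F↭V) (↭-sym (proj₂ complement)))

  e-extendable : Connected G → EExtendable G m n
  e-extendable connected = record
    { connected       = connected
    ; perfectMatching = case extend-matching {[]} ([] , []) z≤n {[]} ([] , []) z≤n of
        λ (F , ((edges , ind) , covers) , _) → F , ((All.map proj₁ edges , ind) , covers)
    ; order           = ℕₚ.<⇒≤ order-bound
    ; extend          = λ where
        N (N-matching , ≡.refl) → record
          { connected       = ∖-connected N-matching ℕₚ.≤-refl
          ; perfectMatching = map₂ proj₁ (extend-matching N-matching ℕₚ.≤-refl {[]} ([] , []) z≤n)
          ; order           = ℕₚ.≤-trans (ℕₚ.+-monoˡ-≤ 2 (ℕₚ.m≤m+n (2 * m) (2 * n))) (ℕₚ.<⇒≤ order-bound)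
          ; extend          = λ M (M-matching , M≡m) →
              extend-matching N-matching ℕₚ.≤-refl M-matching (ℕₚ.≤-reflexive M≡m)
          }
    }

-- Real bounds

module _ where
  open ℤ using (+_)

  -- Not a floor, but the embedding of the naturals, in the form of the terms of `fromℕ`.
  ⌊_⌋ : ℕ → ℚ
  ⌊ n ⌋ = + n ℚ./ 1

  ⌊⌋-+ : ∀ m n → ⌊ m ℕ.+ n ⌋ ≡ ⌊ m ⌋ ℚ.+ ⌊ n ⌋
  ⌊⌋-+ m n = ℚₚ.toℚᵘ-injective (begin
    ℚ.toℚᵘ ⌊ m ℕ.+ n ⌋                    ≈⟨ ℚₚ.toℚᵘ-fromℚᵘ (ℚᵘ.mkℚᵘ (+ (m ℕ.+ n)) 0) ⟩
    ℚᵘ.mkℚᵘ (+ (m ℕ.+ n)) 0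
      ≈⟨ ℚᵘ.*≡* (cong (ℤ._* + 1) (cong₂ ℤ._+_ (≡.sym (ℤₚ.*-identityʳ (+ m)))
            (≡.sym (ℤₚ.*-identityʳ (+ n))))) ⟩
    ℚᵘ.mkℚᵘ (+ m) 0 ℚᵘ.+ ℚᵘ.mkℚᵘ (+ n) 0
      ≈⟨ ℚᵘₚ.+-cong (ℚₚ.toℚᵘ-fromℚᵘ (ℚᵘ.mkℚᵘ (+ m) 0)) (ℚₚ.toℚᵘ-fromℚᵘ (ℚᵘ.mkℚᵘ (+ n) 0)) ⟨
    ℚ.toℚᵘ ⌊ m ⌋ ℚᵘ.+ ℚ.toℚᵘ ⌊ n ⌋        ≈⟨ ℚₚ.toℚᵘ-homo-+ ⌊ m ⌋ ⌊ n ⌋ ⟨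
    ℚ.toℚᵘ (⌊ m ⌋ ℚ.+ ⌊ n ⌋)              ∎)
    where open ℚᵘₚ.≃-Reasoning

  ⌊⌋-nonNeg : ∀ n → 0ℚ ℚ.≤ ⌊ n ⌋
  ⌊⌋-nonNeg n = ℚₚ.nonNegative⁻¹ ⌊ n ⌋ {{ℚₚ.normalize-nonNeg n 1}}

  ⌊⌋-mono : ∀ {m n} → m ℕ.≤ n → ⌊ m ⌋ ℚ.≤ ⌊ n ⌋
  ⌊⌋-mono {m} {n} m≤n = begin
    ⌊ m ⌋                     ≡⟨ ℚₚ.+-identityʳ ⌊ m ⌋ ⟨
    ⌊ m ⌋ ℚ.+ 0ℚ              ≤⟨ ℚₚ.+-monoʳ-≤ ⌊ m ⌋ (⌊⌋-nonNeg (n ℕ.∸ m)) ⟩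
    ⌊ m ⌋ ℚ.+ ⌊ n ℕ.∸ m ⌋     ≡⟨ ⌊⌋-+ m (n ℕ.∸ m) ⟨
    ⌊ m ℕ.+ (n ℕ.∸ m) ⌋       ≡⟨ cong ⌊_⌋ (ℕₚ.m+[n∸m]≡n m≤n) ⟩
    ⌊ n ⌋                     ∎
    where open ℚₚ.≤-Reasoning

  /-*-cancel : ∀ m k → (+ m ℚ./ suc k) ℚ.* ⌊ suc k ⌋ ≡ ⌊ m ⌋
  /-*-cancel m k = ℚₚ.toℚᵘ-injective (begin
    ℚ.toℚᵘ ((+ m ℚ./ suc k) ℚ.* ⌊ suc k ⌋)               ≈⟨ ℚₚ.toℚᵘ-homo-* (+ m ℚ./ suc k) ⌊ suc k ⌋ ⟩
    ℚ.toℚᵘ (+ m ℚ./ suc k) ℚᵘ.* ℚ.toℚᵘ ⌊ suc k ⌋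
      ≈⟨ ℚᵘₚ.*-cong (ℚₚ.toℚᵘ-fromℚᵘ (ℚᵘ.mkℚᵘ (+ m) k)) (ℚₚ.toℚᵘ-fromℚᵘ (ℚᵘ.mkℚᵘ (+ suc k) 0)) ⟩
    ℚᵘ.mkℚᵘ (+ m) k ℚᵘ.* ℚᵘ.mkℚᵘ (+ suc k) 0
      ≈⟨ ℚᵘ.*≡* (≡.trans (ℤₚ.*-identityʳ _)
            (cong (+ m ℤ.*_) (cong +_ (≡.sym (ℕₚ.*-identityʳ (suc k)))))) ⟩
    ℚᵘ.mkℚᵘ (+ m) 0                                      ≈⟨ ℚₚ.toℚᵘ-fromℚᵘ (ℚᵘ.mkℚᵘ (+ m) 0) ⟨
    ℚ.toℚᵘ ⌊ m ⌋                                         ∎)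
    where open ℚᵘₚ.≃-Reasoning

  open ℚ-Solver.+-*-Solver using (solve; con; _:+_; _:*_; _:-_; _:=_)

  -- Multiplication by `f`. Two terms of ε occur because `recip` shifts its sequence: `r` inverts
  -- the shifted term `f`, while `e` is the unshifted one, and `η` bounds the excess of `f` over
  -- `e`.
  clear-denominator : ∀ {κ K B e f r β δ η} →
    K ℚ.* (1ℚ ℚ.+ e) ℚ.* r ℚ.+ δ ℚ.≤ κ → κ ℚ.≤ B → r ℚ.* f ≡ 1ℚ →
    ℚ.NonNegative f → ℚ.NonNegative δ → ℚ.NonNegative B → β ℚ.≤ f → f ℚ.≤ e ℚ.+ η →
    K ℚ.* (1ℚ ℚ.+ e) ℚ.+ δ ℚ.* β ℚ.≤ B ℚ.* (e ℚ.+ η)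
  clear-denominator {κ} {K} {B} {e} {f} {r} {β} {δ} {η} h κ≤B rf≡1 f≥0 δ≥0 B≥0 β≤f f≤e+η = begin
    a ℚ.+ δ ℚ.* β            ≤⟨ ℚₚ.+-monoʳ-≤ a (ℚₚ.*-monoˡ-≤-nonNeg δ {{δ≥0}} β≤f) ⟩
    a ℚ.+ δ ℚ.* f            ≡⟨ cong (ℚ._+ δ ℚ.* f) (≡.trans (cong (a ℚ.*_) rf≡1) (ℚₚ.*-identityʳ a)) ⟨
    a ℚ.* (r ℚ.* f) ℚ.+ δ ℚ.* f
      ≡⟨ solve 4 (λ a r f δ → a :* (r :* f) :+ δ :* f := (a :* r :+ δ) :* f) ≡.refl a r f δ ⟩
    (a ℚ.* r ℚ.+ δ) ℚ.* f    ≤⟨ ℚₚ.*-monoʳ-≤-nonNeg f {{f≥0}} (ℚₚ.≤-trans h κ≤B) ⟩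
    B ℚ.* f                  ≤⟨ ℚₚ.*-monoˡ-≤-nonNeg B {{B≥0}} f≤e+η ⟩
    B ℚ.* (e ℚ.+ η)          ∎
    where
    open ℚₚ.≤-Reasoning
    a = K ℚ.* (1ℚ ℚ.+ e)

  -- The gap `δ * β` is split into two copies of `ρ`: one pays for the error `(K + c) * η` of the
  -- shift, the other survives as a strict margin. The terms `K * e` cancel.
  scaled-ε-bound : ∀ {κ K c e f r β δ η ρ} →
    K ℚ.* (1ℚ ℚ.+ e) ℚ.* r ℚ.+ δ ℚ.≤ κ → κ ℚ.≤ K ℚ.+ c → r ℚ.* f ≡ 1ℚ →
    ℚ.NonNegative f → ℚ.NonNegative δ → ℚ.NonNegative (K ℚ.+ c) → β ℚ.≤ f → f ℚ.≤ e ℚ.+ η →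
    (K ℚ.+ c) ℚ.* η ≡ ρ → δ ℚ.* β ≡ ρ ℚ.+ ρ → K ℚ.+ ρ ℚ.≤ c ℚ.* e
  scaled-ε-bound {κ} {K} {c} {e} {f} {r} {β} {δ} {η} {ρ} h κ≤ rf≡1 f≥0 δ≥0 B≥0 β≤f f≤ Bη≡ρ δβ≡ = begin
    K ℚ.+ ρ
      ≡⟨ solve 3 (λ K e ρ → K :+ ρ
           := (K :* (con 1ℚ :+ e) :+ (ρ :+ ρ)) :+ (con 0ℚ :- K :* e :- ρ)) ≡.refl K e ρ ⟩
    (K ℚ.* (1ℚ ℚ.+ e) ℚ.+ (ρ ℚ.+ ρ)) ℚ.+ (0ℚ ℚ.- K ℚ.* e ℚ.- ρ)
      ≡⟨ cong (λ p → (K ℚ.* (1ℚ ℚ.+ e) ℚ.+ p) ℚ.+ (0ℚ ℚ.- K ℚ.* e ℚ.- ρ)) δβ≡ ⟨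
    (K ℚ.* (1ℚ ℚ.+ e) ℚ.+ δ ℚ.* β) ℚ.+ (0ℚ ℚ.- K ℚ.* e ℚ.- ρ)
      ≤⟨ ℚₚ.+-monoˡ-≤ (0ℚ ℚ.- K ℚ.* e ℚ.- ρ) (clear-denominator {κ} {K} {K ℚ.+ c} {e}
            {f} {r} {β} {δ} {η} h κ≤ rf≡1 f≥0 δ≥0 B≥0 β≤f f≤) ⟩
    (K ℚ.+ c) ℚ.* (e ℚ.+ η) ℚ.+ (0ℚ ℚ.- K ℚ.* e ℚ.- ρ)
      ≡⟨ cong (ℚ._+ (0ℚ ℚ.- K ℚ.* e ℚ.- ρ)) (≡.trans (ℚₚ.*-distribˡ-+ (K ℚ.+ c) e η)
            (cong ((K ℚ.+ c) ℚ.* e ℚ.+_) Bη≡ρ)) ⟩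
    ((K ℚ.+ c) ℚ.* e ℚ.+ ρ) ℚ.+ (0ℚ ℚ.- K ℚ.* e ℚ.- ρ)
      ≡⟨ solve 4 (λ K c e ρ → ((K :+ c) :* e :+ ρ) :+ (con 0ℚ :- K :* e :- ρ) := c :* e) ≡.refl K c e ρ ⟩
    c ℚ.* e ∎
    where open ℚₚ.≤-Reasoning

  divide-bound : ∀ {t c K e ρ ρ/c} → .{{ℚ.Positive c}} → t ℚ.* c ℚ.≤ K ℚ.+ c →
    K ℚ.+ ρ ℚ.≤ c ℚ.* e → ρ/c ℚ.* c ≡ ρ → t ℚ.+ ρ/c ℚ.≤ 1ℚ ℚ.+ e
  divide-bound {t} {c} {K} {e} {ρ} {ρ/c} tc≤ Kρ≤ ρ/c*c = ℚₚ.*-cancelʳ-≤-pos c (begin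
    (t ℚ.+ ρ/c) ℚ.* c
      ≡⟨ ≡.trans (ℚₚ.*-distribʳ-+ c t ρ/c) (cong (t ℚ.* c ℚ.+_) ρ/c*c) ⟩
    t ℚ.* c ℚ.+ ρ
      ≤⟨ ℚₚ.+-monoˡ-≤ ρ tc≤ ⟩
    (K ℚ.+ c) ℚ.+ ρ
      ≡⟨ solve 3 (λ K c ρ → (K :+ c) :+ ρ := c :+ (K :+ ρ)) ≡.refl K c ρ ⟩
    c ℚ.+ (K ℚ.+ ρ)
      ≤⟨ ℚₚ.+-monoʳ-≤ c Kρ≤ ⟩
    c ℚ.+ c ℚ.* e
      ≡⟨ solve 2 (λ c e → c :+ c :* e := (con 1ℚ :+ e) :* c) ≡.refl c e ⟩
    (1ℚ ℚ.+ e) ℚ.* c ∎)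
    where open ℚₚ.≤-Reasoning

  p/q*q≡p : ∀ p q → .{{_ : ℚ.NonZero q}} → p ℚ.* ℚ.1/ q ℚ.* q ≡ p
  p/q*q≡p p q = ≡.trans (ℚₚ.*-assoc p (ℚ.1/ q) q)
    (≡.trans (cong (p ℚ.*_) (ℚₚ.*-inverseˡ q)) (ℚₚ.*-identityʳ p))

  p≤∣p∣ : ∀ p → p ℚ.≤ ℚ.∣ p ∣
  p≤∣p∣ p with ℚₚ.≤-total 0ℚ p
  ... | inj₁ 0≤p = ℚₚ.≤-reflexive (≡.sym (ℚₚ.0≤p⇒∣p∣≡p 0≤p))
  ... | inj₂ p≤0 = ℚₚ.≤-trans p≤0 (ℚₚ.0≤∣p∣ p)

  ∣p-q∣≤r⇒p≤q+r : ∀ {p q r} → ℚ.∣ p ℚ.- q ∣ ℚ.≤ r → p ℚ.≤ q ℚ.+ r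
  ∣p-q∣≤r⇒p≤q+r {p} {q} {r} close = begin
    p               ≡⟨ solve 2 (λ p q → p := q :+ (p :- q)) ≡.refl p q ⟩
    q ℚ.+ (p ℚ.- q) ≤⟨ ℚₚ.+-monoʳ-≤ q (ℚₚ.≤-trans (p≤∣p∣ (p ℚ.- q)) close) ⟩
    q ℚ.+ r         ∎
    where open ℚₚ.≤-Reasoning

  -- With c components the toughness bound gives 1 + ε ≤ (K + c) / c, that is
  -- c ≤ K / ε, whereas the connectivity bound says κ > K + K / ε.
  module _ (ε : ℝ) {β : ℚ} (β>0 : ℚ.Positive β) {L : ℕ} (β≤ : ∀ {i} → L ℕ.≤ i → β ℚ.≤ seq ε i)
           {δ : ℚ} (δ>0 : ℚ.Positive δ) {N : ℕ} {K c κ t : ℚ} (K≥0 : 0ℚ ℚ.≤ K) (c>0 : ℚ.Positive c)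
           (κ≤ : κ ℚ.≤ K ℚ.+ c) (tc≤ : t ℚ.* c ℚ.≤ K ℚ.+ c)
           (r : ℕ → ℚ) (r-inverse : ∀ i → r i ℚ.* seq ε (L ℕ.+ i) ≡ 1ℚ)
           (gap : ∀ {i} → N ℕ.≤ i → K ℚ.* (1ℚ ℚ.+ seq ε i) ℚ.* r i ℚ.+ δ ℚ.≤ κ) where
    private
      B = K ℚ.+ c
      ρ = ½ ℚ.* (δ ℚ.* β)
      B>0 : ℚ.Positive B
      B>0 = ℚ.positive (ℚₚ.+-mono-≤-< K≥0 (ℚₚ.positive⁻¹ c {{c>0}}))
      c≢0 : ℚ.NonZero c
      c≢0 = ℚₚ.pos⇒nonZero c {{c>0}}
      B≢0 : ℚ.NonZero B
      B≢0 = ℚₚ.pos⇒nonZero B {{B>0}}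
      ρ>0 : ℚ.Positive ρ
      ρ>0 = ℚₚ.pos*pos⇒pos ½ (δ ℚ.* β) {{ℚₚ.pos*pos⇒pos δ {{δ>0}} β {{β>0}}}}
      ρ/c = ρ ℚ.* (ℚ.1/ c) {{c≢0}}
      η   = ρ ℚ.* (ℚ.1/ B) {{B≢0}}
      closeness = cauchy ε η {{ℚₚ.pos*pos⇒pos ρ {{ρ>0}} ((ℚ.1/ B) {{B≢0}}) {{ℚₚ.1/pos⇒pos B {{B>0}}}}}}

      ε-large : ∀ {i} → N ℕ.≤ i → proj₁ closeness ℕ.≤ i → t ℚ.+ ρ/c ℚ.≤ 1ℚ ℚ.+ seq ε i
      ε-large {i} N≤i M≤i = divide-bound {t} {c} {K} {seq ε i} {ρ} {ρ/c} {{c>0}} tc≤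
        (scaled-ε-bound {κ} {K} {c} {seq ε i} {f} {r i} {β} {δ} {η} {ρ} (gap N≤i) κ≤ (r-inverse i)
          (ℚ.nonNegative (ℚₚ.≤-trans (ℚₚ.<⇒≤ (ℚₚ.positive⁻¹ β {{β>0}})) β≤f))
          (ℚₚ.pos⇒nonNeg δ {{δ>0}}) (ℚₚ.pos⇒nonNeg B {{B>0}}) β≤f
          -- Both indices, `L + i` and `i`, are past the Cauchy threshold for `η`.
          (∣p-q∣≤r⇒p≤q+r {f} {seq ε i} {η} (proj₂ closeness (ℕₚ.≤-trans M≤i (ℕₚ.m≤n+m i L)) M≤i))
          (≡.trans (ℚₚ.*-comm B η) (p/q*q≡p ρ B {{B≢0}}))
          (≡.trans (≡.sym (ℚₚ.*-identityˡ (δ ℚ.* β))) (ℚₚ.*-distribʳ-+ (δ ℚ.* β) ½ ½)))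
        (p/q*q≡p ρ c {{c≢0}})
        where
        f = seq ε (L ℕ.+ i)
        β≤f : β ℚ.≤ f
        β≤f = β≤ (ℕₚ.m≤m+n L i)

    t<1+ε : fromℚ t <ᵣ 1ᵣ +ᵣ ε
    t<1+ε = ρ/c , ℚₚ.pos*pos⇒pos ρ {{ρ>0}} ((ℚ.1/ c) {{c≢0}}) {{ℚₚ.1/pos⇒pos c {{c>0}}}} ,
      N ℕ.⊔ proj₁ closeness , λ N≤i →
        ε-large (ℕₚ.m⊔n≤o⇒m≤o N (proj₁ closeness) N≤i) (ℕₚ.m⊔n≤o⇒n≤o N (proj₁ closeness) N≤i)

-- The order `≤ᵣ` is a negated strict order, so it is enough to turn `s ≤ K + suc k` into a rational
-- margin by which `t` stays below 1 + ε.
connectivity-bound : ∀ (ε : ℝ) (ε>0 : 0ᵣ <ᵣ ε) (t : ℚ) → 1ᵣ +ᵣ ε ≤ᵣ fromℚ t →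
  ∀ K κ → fromℕ K *ᵣ (1ᵣ +ᵣ ε) *ᵣ recip ε ε>0 <ᵣ fromℕ κ →
  ∀ k s → t ℚ.≤ ℤ.+ s ℚ./ suc k → κ ≤ s → K + suc k < s
connectivity-bound ε ε>0@(β , β>0 , L , β≤) t 1+ε≤t K κ (δ , δ>0 , N , gap) k s t≤ κ≤s =
  ℕₚ.≰⇒> λ s≤ → 1+ε≤t (t<1+ε ε β>0 β≤seq δ>0 {K = ⌊ K ⌋} {⌊ suc k ⌋} {⌊ κ ⌋} {t} (⌊⌋-nonNeg K) c>0
    (ℚₚ.≤-trans (⌊⌋-mono κ≤s) (⌊s⌋≤ s≤)) (tc≤ s≤) (seq (recip ε ε>0)) inverse gap)
  where
  c>0 : ℚ.Positive ⌊ suc k ⌋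
  c>0 = ℚₚ.normalize-pos (suc k) 1
  β≤seq : ∀ {i} → L ≤ i → β ℚ.≤ seq ε i
  β≤seq {i} L≤i = subst (ℚ._≤ seq ε i) (ℚₚ.+-identityˡ β) (β≤ L≤i)
  ⌊s⌋≤ : s ≤ K + suc k → ⌊ s ⌋ ℚ.≤ ⌊ K ⌋ ℚ.+ ⌊ suc k ⌋
  ⌊s⌋≤ s≤ = subst (⌊ s ⌋ ℚ.≤_) (⌊⌋-+ K (suc k)) (⌊⌋-mono s≤)
  tc≤ : s ≤ K + suc k → t ℚ.* ⌊ suc k ⌋ ℚ.≤ ⌊ K ⌋ ℚ.+ ⌊ suc k ⌋
  tc≤ s≤ = ℚₚ.≤-trans (ℚₚ.*-monoʳ-≤-nonNeg ⌊ suc k ⌋ {{ℚₚ.pos⇒nonNeg ⌊ suc k ⌋ {{c>0}}}} t≤)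
    (subst (ℚ._≤ ⌊ K ⌋ ℚ.+ ⌊ suc k ⌋) (≡.sym (/-*-cancel s k)) (⌊s⌋≤ s≤))
  inverse : ∀ i → seq (recip ε ε>0) i ℚ.* seq ε (L + i) ≡ 1ℚ
  inverse i = ℚₚ.*-inverseˡ (seq ε (L + i)) {{ℚₚ.pos⇒nonZero (seq ε (L + i)) {{tail>0}}}}
    where
    tail>0 : ℚ.Positive (seq ε (L + i))
    tail>0 = ℚ.positive (ℚₚ.<-≤-trans (ℚₚ.positive⁻¹ β {{β>0}}) (β≤seq (ℕₚ.m≤m+n L i)))

components⇒cutSet : ∀ {v} (G : Graph (Fin v)) {S c} → ComponentCount (G − S) c → 2 ≤ c → CutSet G S
components⇒cutSet G (label , onto , label⇔path) (s≤s (s≤s _)) connected =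
  case ≡.trans (≡.sym (proj₂ (onto zero)))
         (≡.trans (Equivalence.from (label⇔path _ _) (connected _ _)) (proj₂ (onto (suc zero)))) of λ ()

corollary3p3 :
    (m n : ℕ) → 0 < m → 0 < n →
    (ε : ℝ) (ε>0 : 0ᵣ <ᵣ ε) →
    (v : ℕ) (G : Graph (Fin v)) →
    Connected G → ¬ Complete G → 2 ∣ v →
    (t : ℚ) → IsToughness G t → 1ᵣ +ᵣ ε ≤ᵣ fromℚ t →
    (κ : ℕ) → IsVertexConnectivity G κ →
    fromℕ (2 * m + 2 * n ∸ 2) *ᵣ (1ᵣ +ᵣ ε) *ᵣ recip ε ε>0 <ᵣ fromℕ κ →
    EExtendable G m n
corollary3p3 m n _ _ ε ε>0 v G connected ¬complete 2∣v t (_ , t-min) 1+ε≤t κ (_ , κ-min) κ-large =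
  e-extendable G 2∣v ¬complete m n tough connected
  where
  open ℕₚ.≤-Reasoning
  open ℕ-Solver.+-*-Solver using (solve; con; _:+_; _:=_)
  K = 2 * m + 2 * n ∸ 2
  -- With two components `T` is a cut set, so both minima apply to it: `t` is at most its ratio and
  -- `κ` at most its size.
  tough : ∀ T c → ComponentCount (G − T) c → 2 ≤ c → c + 2 * (m + n) < ∣ T ∣ + 2
  tough T c@(suc k) count 2≤c = begin-strict
    c + 2 * (m + n)      ≡⟨ cong (c +_) (ℕₚ.*-distribˡ-+ 2 m n) ⟩
    -- The truncated difference `K` is never below the true one, which is the direction required.
    c + (2 * m + 2 * n)  ≤⟨ ℕₚ.+-monoʳ-≤ c (ℕₚ.m≤n+m∸n (2 * m + 2 * n) 2) ⟩
    c + (2 + K)          ≡⟨ solve 2 (λ c K → c :+ (con 2 :+ K) := (K :+ c) :+ con 2) ≡.refl c K ⟩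
    K + c + 2            <⟨ ℕₚ.+-monoˡ-< 2 (connectivity-bound ε ε>0 t 1+ε≤t K κ κ-large k ∣ T ∣
                              (t-min _ (T , k , cut , count , ≡.refl))
                              (κ-min _ (T , inj₁ cut , ≡.refl))) ⟩
    ∣ T ∣ + 2            ∎
    where cut = components⇒cutSet G count 2≤c
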